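{- For $n\ge 3$ let $S_2(n,1)$ be the $1$-out $2$-complex on the vertex set $[n]$. Then \[\frac{\dim H_1(S_2(n,1),\mathbb{F}_2)}{n^2}\] converges to $0$ in probability as $n\to\infty$.
   Context: The $1$-out $2$-complex $S_2(n,1)$ is the random $2$-dimensional simplicial complex obtained as follows: start with the complete graph on $[n]=\{1,\dots,n\}$, and independently for each edge $\{u,v\}$ choose a vertex $w\in[n]\setminus\{u,v\}$ uniformly at random and add the triangular face $\{u,v,w\}$; if a triangle is chosen at several edges, only one copy is kept. -}

module Defs where

open import Data.Bool using (Bool; true; false; _xor_; _∨_; _∧_)
open import Data.Nat using (ℕ; suc; _+_; _*_; _≤_; _<_)
open import Data.Fin using (Fin) renaming (_<_ to _<ᶠ_; _<?_ to _<ᶠ?_; _≟_ to _≟ᶠ_)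
open import Data.List using (List; []; _∷_; [_]; map; concatMap; filter; length; zipWith; foldr; allFin)
open import Data.List.Relation.Binary.Sublist.Propositional using (_⊆_)
open import Data.List.Membership.Propositional using (_∈_)
open import Data.Product using (Σ; Σ-syntax; _×_; _,_)
open import Relation.Binary.PropositionalEquality using (_≡_; _≢_)
open import Relation.Nullary using (¬_)
open import Relation.Nullary.Decidable using (⌊_⌋; ¬?; _×-dec_)

Vec₂ : Set → Set
Vec₂ X = X → Bool

zeroV : {X : Set} → Vec₂ X
zeroV _ = false

_+V_ : {X : Set} → Vec₂ X → Vec₂ X → Vec₂ X
(u +V v) x = u x xor v x

sumV : {X : Set} → List (Vec₂ X) → Vec₂ X
sumV = foldr _+V_ zeroV

IsZero : {X : Set} → Vec₂ X → Set
IsZero v = ∀ x → v x ≡ false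

-- a list of vectors is linearly independent over F₂ iff no nonempty
-- sub-selection sums to zero (a repeated vector makes the list dependent)
Independent : {X : Set} → List (Vec₂ X) → Set
Independent vs = ∀ ts → ts ⊆ vs → ts ≢ [] → ¬ IsZero (sumV ts)

HasRank : {X : Set} → List (Vec₂ X) → ℕ → Set
HasRank vs r =
  (Σ[ ts ∈ List _ ] (ts ⊆ vs × Independent ts × length ts ≡ r)) ×
  (∀ ts → ts ⊆ vs → Independent ts → length ts ≤ r)

Edge : ℕ → Set
Edge n = Σ[ i ∈ Fin n ] Σ[ j ∈ Fin n ] (i <ᶠ j)

edges : (n : ℕ) → List (Fin n × Fin n)
edges n = concatMap (λ i → map (λ j → (i , j)) (filter (i <ᶠ?_) (allFin n))) (allFin n)

∂₁ : {n : ℕ} → Fin n × Fin n → Vec₂ (Fin n)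
∂₁ (a , b) x = ⌊ x ≟ᶠ a ⌋ ∨ ⌊ x ≟ᶠ b ⌋

isPair : {n : ℕ} → Fin n → Fin n → Edge n → Bool
isPair a b (i , j , _) = (⌊ i ≟ᶠ a ⌋ ∧ ⌊ j ≟ᶠ b ⌋) ∨ (⌊ i ≟ᶠ b ⌋ ∧ ⌊ j ≟ᶠ a ⌋)

-- boundary ∂₂ of the triangle {u,v,w} (u,v,w distinct) : a 1-chain
∂₂ : {n : ℕ} → Fin n → Fin n → Fin n → Vec₂ (Edge n)
∂₂ u v w e = isPair u v e ∨ isPair u w e ∨ isPair v w e

choices : (n : ℕ) → Fin n × Fin n → List (Fin n)
choices n (u , v) = filter (λ w → ¬? (w ≟ᶠ u) ×-dec ¬? (w ≟ᶠ v)) (allFin n)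

cartesian : {A : Set} → List (List A) → List (List A)
cartesian [] = [ [] ]
cartesian (xs ∷ xss) = concatMap (λ x → map (x ∷_) (cartesian xss)) xs

-- all outcomes: one choice of w per edge (aligned with 'edges n');
-- these are pairwise distinct and the uniform measure on this list is
-- the law of S₂(n,1)
outcomes : (n : ℕ) → List (List (Fin n))
outcomes n = cartesian (map (choices n) (edges n))

-- the 2-faces of S₂(n,1) for outcome ω (a repeated triangle may occur
-- twice in the list; this does not affect the rank of ∂₂)
faceBoundaries : (n : ℕ) → List (Fin n) → List (Vec₂ (Edge n))
faceBoundaries n ω = zipWith (λ { (u , v) w → ∂₂ u v w }) (edges n) ω

IsDimH₁ : (n : ℕ) → List (Fin n) → ℕ → Set
IsDimH₁ n ω b = Σ[ r₁ ∈ ℕ ] Σ[ r₂ ∈ ℕ ]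
  (HasRank (map ∂₁ (edges n)) r₁ × HasRank (faceBoundaries n ω) r₂ ×
   b + r₁ + r₂ ≡ length (edges n))

-- "dim H₁ / n² > p / (q+1)"
BigH₁ : (n : ℕ) → ℕ → ℕ → List (Fin n) → Set
BigH₁ n p q ω = Σ[ b ∈ ℕ ] (IsDimH₁ n ω b × p * (n * n) < b * suc q)

-- Pr[ω satisfies P] ≤ a / (c+1) under the uniform measure on outcomes n:
-- there is a sub-selection L of outcomes containing every outcome
-- satisfying P, with |L| ≤ (a/(c+1)) · |outcomes n|
ProbAtMost : (n : ℕ) → (List (Fin n) → Set) → ℕ → ℕ → Set
ProbAtMost n P a c =
  Σ[ L ∈ List (List (Fin n)) ]
    (L ⊆ outcomes n ×
     (∀ ω → ω ∈ outcomes n → P ω → ω ∈ L) ×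
     length L * suc c ≤ a * length (outcomes n))

{-# OPTIONS --safe #-}

-- First moment method. A 1-cochain C is a cocycle of S₂(n,1) when each edge uv chose some w with
-- C(uv) = C(uw) + C(vw); the number of cocycles is at least 2^(dim H₁), so by Markov it suffices that
-- its expectation Σ_C Π_uv Pr[C(uv) = C(uw) + C(vw)] is 2^o(n²). Were the law of C(uw) + C(vw) replaced
-- by one not depending on C, the sum over C would factor over the edges into factors 1. Sampling boundedly
-- many vertices w achieves this up to a small error: by Chebyshev some sample of K columns of C predicts
-- the law within 1/D on all but M/D² of the M edges, and the columns take only 2^(Kn) values.
module Submission where

open import Defs
open import Data.Nat using (ℕ; zero; suc; _+_; _*_; _^_; _∸_; _/_; _≤_; _<_; _≰_; z≤n; s≤s; s≤s⁻¹; z<s; NonZero; >-nonZero; >-nonZero⁻¹)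
open import Data.Product using (Σ-syntax; ∃-syntax; _×_; _,_; proj₁; proj₂)
open import Algebra.Bundles using (CommutativeRing)
open import Data.Bool using (Bool; true; false; if_then_else_; not; _∧_; _∨_; _xor_)
open import Data.Bool.Properties using (xor-comm; xor-identityʳ; ∧-distribʳ-xor; ∧-distribˡ-xor; ∧-zeroʳ; ∧-identityʳ; ∨-comm; xor-∧-commutativeRing)
open import Data.Fin using (Fin; zero; suc; _<?_; _≟_) renaming (_<_ to _<ᶠ_)
open import Data.Fin.Properties using (<-cmp; <-irrefl; <-asym)
open import Data.Integer using (ℤ; 0ℤ; -[1+_]; +≤+; ∣_∣) renaming (+_ to ⁺_; _+_ to _+ᶻ_; _*_ to _*ᶻ_; _≤_ to _≤ᶻ_; -_ to -ᶻ_)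
import Data.Integer.Properties as ℤ
open import Data.Integer.Tactic.RingSolver using () renaming (solve-∀ to ℤ-solve-∀)
open import Data.List using (List; []; _∷_; _++_; map; concatMap; filter; length; allFin; zipWith)
open import Data.List.Membership.Propositional using (_∈_; lose; find)
open import Data.List.Membership.Propositional.Properties using (∈-concatMap⁻; ∈-concatMap⁺; ∈-map⁻; ∈-map⁺; ∈-filter⁻; ∈-filter⁺)
open import Data.List.Properties using (map-tabulate; length-tabulate)
open import Data.List.Relation.Binary.Sublist.Propositional using (_⊆_; _∷_; _∷ʳ_)
open import Data.List.Relation.Binary.Sublist.Propositional.Properties using (All-resp-⊆; filter-⊆)
open import Data.List.Relation.Unary.All using (All; []; _∷_)
open import Data.List.Relation.Unary.Any using (here; there)
open import Data.Nat.DivMod using (/-monoˡ-≤; m*n/n≡m; m/n*n≤m; m%n<n; m≡m%n+[m/n]*n)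
open import Data.Nat.Properties hiding (_<?_; _≟_; <-cmp; <-irrefl; <-asym)
import Data.Nat.Properties as ℕ
open import Data.Nat.Tactic.RingSolver using () renaming (solve-∀ to ℕ-solve-∀)
open import Data.Sum as Sum using (_⊎_; inj₁; inj₂)
open import Data.Vec as Vec using (Vec; []; _∷_; lookup; toList)
open import Data.Vec.Properties using (lookup-zipWith; lookup∘tabulate; toList-map; length-toList)
open import Function using (_∘_; id)
open import Relation.Binary using (tri<; tri≈; tri>)
open import Relation.Binary.PropositionalEquality
open import Relation.Nullary using (Dec; does; yes; no; contradiction; ⌊_⌋; ¬?; _×-dec_)
open import Relation.Nullary.Decidable using (dec-true; dec-false)
open import Relation.Unary using (Decidable)
open import Algebra.Properties.CommutativeSemigroup +-commutativeSemigroup using () renaming (interchange to +-interchange)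
open import Algebra.Properties.CommutativeSemigroup *-commutativeSemigroup using () renaming (interchange to *-interchange)
open import Algebra.Properties.CommutativeSemigroup (CommutativeRing.+-commutativeSemigroup xor-∧-commutativeRing) using () renaming (interchange to xor-interchange)

-- The obstacle is that the factor at the edge uv depends on the entries of C at all edges from u
-- and v, so the sum over C does not factor as it stands. Two devices make the replacement
-- affordable. The predicted frequency is raised by 1/D: where the sample is accurate it then bounds
-- the true frequency from above, and where the sample fails it is still at least 1/D, so that such
-- an edge costs only a factor D. The raised frequencies of the two values of C(uv) add up to 1 +
-- 2/D instead of 1. Secondly, the sample may depend on C, because the columns that it reveals are
-- summed over as if they were arbitrary: once they are fixed, C runs through all cochains, with no
-- consistency demanded, and each entry occurs in one factor only. This bounds the expected number
-- of cocycles by 2^(M/D + nK) times ((1 + 2/D) n/(n-2))^M. With D a large multiple of q+1 the terms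
-- of the exponent linear in M are a small fraction of n²/(q+1); n is then taken large against K.

private variable
  A B : Set

-- Finite sums and products

ι : Bool → ℕ
ι false = 0
ι true  = 1

∑ ∏ : List A → (A → ℕ) → ℕ
∑ []       f = 0
∑ (x ∷ xs) f = f x + ∑ xs f
∏ []       f = 1
∏ (x ∷ xs) f = f x * ∏ xs f

∑-mono-∈ : (xs : List A) {f g : A → ℕ} → (∀ {x} → x ∈ xs → f x ≤ g x) → ∑ xs f ≤ ∑ xs g
∑-mono-∈ []       h = z≤n
∑-mono-∈ (x ∷ xs) h = +-mono-≤ (h (here refl)) (∑-mono-∈ xs (h ∘ there))

∑-mono : (xs : List A) {f g : A → ℕ} → (∀ x → f x ≤ g x) → ∑ xs f ≤ ∑ xs g
∑-mono xs h = ∑-mono-∈ xs (λ {x} _ → h x)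

∑-cong : (xs : List A) {f g : A → ℕ} → (∀ x → f x ≡ g x) → ∑ xs f ≡ ∑ xs g
∑-cong []       h = refl
∑-cong (x ∷ xs) h = cong₂ _+_ (h x) (∑-cong xs h)

∑-+ : (xs : List A) (f g : A → ℕ) → ∑ xs (λ x → f x + g x) ≡ ∑ xs f + ∑ xs g
∑-+ []       f g = refl
∑-+ (x ∷ xs) f g = trans (cong (f x + g x +_) (∑-+ xs f g)) (+-interchange (f x) (g x) (∑ xs f) (∑ xs g))

∑-*ˡ : (xs : List A) (c : ℕ) (f : A → ℕ) → ∑ xs (λ x → c * f x) ≡ c * ∑ xs f
∑-*ˡ []       c f = sym (*-zeroʳ c)
∑-*ˡ (x ∷ xs) c f = trans (cong (c * f x +_) (∑-*ˡ xs c f)) (sym (*-distribˡ-+ c (f x) (∑ xs f)))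

∑-*ʳ : (xs : List A) (c : ℕ) (f : A → ℕ) → ∑ xs (λ x → f x * c) ≡ ∑ xs f * c
∑-*ʳ xs c f = trans (∑-cong xs (λ x → *-comm (f x) c)) (trans (∑-*ˡ xs c f) (*-comm c (∑ xs f)))

∑-const : (xs : List A) (c : ℕ) → ∑ xs (λ _ → c) ≡ length xs * c
∑-const []       c = refl
∑-const (x ∷ xs) c = cong (c +_) (∑-const xs c)

∑-swap : (xs : List A) (ys : List B) (f : A → B → ℕ) →
         ∑ xs (λ x → ∑ ys (f x)) ≡ ∑ ys (λ y → ∑ xs (λ x → f x y))
∑-swap []       ys f = sym (trans (∑-const ys 0) (*-zeroʳ (length ys)))
∑-swap (x ∷ xs) ys f = trans (cong (∑ ys (f x) +_) (∑-swap xs ys f)) (sym (∑-+ ys (f x) _))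

∑-++ : (xs ys : List A) (f : A → ℕ) → ∑ (xs ++ ys) f ≡ ∑ xs f + ∑ ys f
∑-++ []       ys f = refl
∑-++ (x ∷ xs) ys f = trans (cong (f x +_) (∑-++ xs ys f)) (sym (+-assoc (f x) _ _))

∑-map : (g : A → B) (xs : List A) (f : B → ℕ) → ∑ (map g xs) f ≡ ∑ xs (f ∘ g)
∑-map g []       f = refl
∑-map g (x ∷ xs) f = cong (f (g x) +_) (∑-map g xs f)

∑-concatMap : (g : A → List B) (xs : List A) (f : B → ℕ) →
              ∑ (concatMap g xs) f ≡ ∑ xs (λ x → ∑ (g x) f)
∑-concatMap g []       f = refl
∑-concatMap g (x ∷ xs) f = trans (∑-++ (g x) (concatMap g xs) f) (cong (∑ (g x) f +_) (∑-concatMap g xs f))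

∑-filter-≤ : {P : A → Set} (P? : Decidable P) (xs : List A) (f : A → ℕ) → ∑ (filter P? xs) f ≤ ∑ xs f
∑-filter-≤ P? []       f = z≤n
∑-filter-≤ P? (x ∷ xs) f with P? x
... | yes _ = +-monoʳ-≤ (f x) (∑-filter-≤ P? xs f)
... | no  _ = ≤-trans (∑-filter-≤ P? xs f) (m≤n+m _ (f x))

≤∑ : {xs : List A} {x : A} (f : A → ℕ) → x ∈ xs → f x ≤ ∑ xs f
≤∑ f (here refl) = m≤m+n _ _
≤∑ {xs = y ∷ _} f (there x∈xs) = ≤-trans (≤∑ f x∈xs) (m≤n+m _ (f y))

-- Strictness does double duty: it excludes the empty list, and over ℕ it turns an average below
-- `c + 1` into a value at most `c`.
∑-pigeonhole : (xs : List A) (f : A → ℕ) (c : ℕ) → ∑ xs f < suc c * length xs →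
               Σ[ x ∈ A ] (x ∈ xs × f x ≤ c)
∑-pigeonhole []       f c h = contradiction (subst (0 <_) (*-zeroʳ (suc c)) h) n≮0
∑-pigeonhole (x ∷ xs) f c h with f x ≤? c
... | yes fx≤c = x , here refl , fx≤c
... | no  fx≰c =
  let y , y∈xs , fy≤c = ∑-pigeonhole xs f c (+-cancelˡ-< (suc c) _ _
        (≤-<-trans (+-monoˡ-≤ (∑ xs f) (≰⇒> fx≰c)) (subst (f x + ∑ xs f <_) (*-suc (suc c) (length xs)) h)))
  in y , there y∈xs , fy≤c

∏-mono-∈ : (xs : List A) {f g : A → ℕ} → (∀ {x} → x ∈ xs → f x ≤ g x) → ∏ xs f ≤ ∏ xs g
∏-mono-∈ []       h = ≤-refl
∏-mono-∈ (x ∷ xs) h = *-mono-≤ (h (here refl)) (∏-mono-∈ xs (h ∘ there))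

∏-cong-∈ : (xs : List A) {f g : A → ℕ} → (∀ {x} → x ∈ xs → f x ≡ g x) → ∏ xs f ≡ ∏ xs g
∏-cong-∈ []       h = refl
∏-cong-∈ (x ∷ xs) h = cong₂ _*_ (h (here refl)) (∏-cong-∈ xs (h ∘ there))

∏-cong : (xs : List A) {f g : A → ℕ} → (∀ x → f x ≡ g x) → ∏ xs f ≡ ∏ xs g
∏-cong xs h = ∏-cong-∈ xs (λ {x} _ → h x)

∏-* : (xs : List A) (f g : A → ℕ) → ∏ xs (λ x → f x * g x) ≡ ∏ xs f * ∏ xs g
∏-* []       f g = refl
∏-* (x ∷ xs) f g = trans (cong (f x * g x *_) (∏-* xs f g)) (*-interchange (f x) (g x) (∏ xs f) (∏ xs g))

∏-const : (xs : List A) (c : ℕ) → ∏ xs (λ _ → c) ≡ c ^ length xs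
∏-const []       c = refl
∏-const (x ∷ xs) c = cong (c *_) (∏-const xs c)

∏-^ : (xs : List A) (c : ℕ) (f : A → ℕ) → ∏ xs (λ x → c ^ f x) ≡ c ^ ∑ xs f
∏-^ []       c f = refl
∏-^ (x ∷ xs) c f = trans (cong (c ^ f x *_) (∏-^ xs c f)) (sym (^-distribˡ-+-* c (f x) (∑ xs f)))

∏-++ : (xs ys : List A) (f : A → ℕ) → ∏ (xs ++ ys) f ≡ ∏ xs f * ∏ ys f
∏-++ []       ys f = sym (*-identityˡ _)
∏-++ (x ∷ xs) ys f = trans (cong (f x *_) (∏-++ xs ys f)) (sym (*-assoc (f x) _ _))

∏-map : (g : A → B) (xs : List A) (f : B → ℕ) → ∏ (map g xs) f ≡ ∏ xs (f ∘ g)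
∏-map g []       f = refl
∏-map g (x ∷ xs) f = cong (f (g x) *_) (∏-map g xs f)

∏-concatMap : (g : A → List B) (xs : List A) (f : B → ℕ) →
              ∏ (concatMap g xs) f ≡ ∏ xs (λ x → ∏ (g x) f)
∏-concatMap g []       f = refl
∏-concatMap g (x ∷ xs) f = trans (∏-++ (g x) (concatMap g xs) f) (cong (∏ (g x) f *_) (∏-concatMap g xs f))

∏-filter : {P : A → Set} (P? : Decidable P) (xs : List A) (f : A → ℕ) →
           ∏ (filter P? xs) f ≡ ∏ xs (λ x → if does (P? x) then f x else 1)
∏-filter P? []       f = refl
∏-filter P? (x ∷ xs) f with P? x
... | yes _ = cong (f x *_) (∏-filter P? xs f)
... | no  _ = trans (∏-filter P? xs f) (sym (*-identityˡ _))

allFin-suc : ∀ n → allFin (suc n) ≡ zero ∷ map suc (allFin n)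
allFin-suc n = cong (zero ∷_) (sym (map-tabulate id suc))

length-allFin : ∀ n → length (allFin n) ≡ n
length-allFin n = length-tabulate id

∏-allFin-suc : ∀ n (f : Fin (suc n) → ℕ) → ∏ (allFin (suc n)) f ≡ f zero * ∏ (allFin n) (f ∘ suc)
∏-allFin-suc n f = trans (cong (λ xs → ∏ xs f) (allFin-suc n)) (cong (f zero *_) (∏-map suc (allFin n) f))

∑-allFin-suc : ∀ n (f : Fin (suc n) → ℕ) → ∑ (allFin (suc n)) f ≡ f zero + ∑ (allFin n) (f ∘ suc)
∑-allFin-suc n f = trans (cong (λ xs → ∑ xs f) (allFin-suc n)) (cong (f zero +_) (∑-map suc (allFin n) f))

-- Sums over tuples

vecs : List A → ∀ m → List (Vec A m)
vecs xs zero    = [] ∷ []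
vecs xs (suc m) = concatMap (λ x → map (x ∷_) (vecs xs m)) xs

∑-vecs-suc : (xs : List A) (m : ℕ) (F : Vec A (suc m) → ℕ) →
             ∑ (vecs xs (suc m)) F ≡ ∑ xs (λ x → ∑ (vecs xs m) (λ v → F (x ∷ v)))
∑-vecs-suc xs m F = trans (∑-concatMap (λ x → map (x ∷_) (vecs xs m)) xs F)
                          (∑-cong xs (λ x → ∑-map (x ∷_) (vecs xs m) F))

length-∑ : (xs : List A) → length xs ≡ ∑ xs (λ _ → 1)
length-∑ xs = sym (trans (∑-const xs 1) (*-identityʳ _))

length-vecs : (xs : List A) (m : ℕ) → length (vecs xs m) ≡ length xs ^ m
length-vecs xs zero    = refl
length-vecs xs (suc m) = begin
  length (vecs xs (suc m))                    ≡⟨ length-∑ (vecs xs (suc m)) ⟩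
  ∑ (vecs xs (suc m)) (λ _ → 1)               ≡⟨ ∑-vecs-suc xs m _ ⟩
  ∑ xs (λ _ → ∑ (vecs xs m) (λ _ → 1))        ≡⟨ ∑-const xs _ ⟩
  length xs * ∑ (vecs xs m) (λ _ → 1)         ≡⟨ cong (length xs *_) (length-∑ (vecs xs m)) ⟨
  length xs * length (vecs xs m)              ≡⟨ cong (length xs *_) (length-vecs xs m) ⟩
  length xs * length xs ^ m                   ∎
  where open ≡-Reasoning

-- The distributive law. Applied to the rows of a matrix and then to the bits of a row, it turns a
-- sum over cochains into a product over positions.
∑-vecs-∏ : (xs : List A) (m : ℕ) (G : Fin m → A → ℕ) →
           ∑ (vecs xs m) (λ v → ∏ (allFin m) (λ i → G i (lookup v i))) ≡ ∏ (allFin m) (λ i → ∑ xs (G i))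
∑-vecs-∏ xs zero    G = refl
∑-vecs-∏ xs (suc m) G = begin
  ∑ (vecs xs (suc m)) (λ v → ∏ (allFin (suc m)) (λ i → G i (lookup v i)))
    ≡⟨ ∑-vecs-suc xs m _ ⟩
  ∑ xs (λ x → ∑ (vecs xs m) (λ v → ∏ (allFin (suc m)) (λ i → G i (lookup (x ∷ v) i))))
    ≡⟨ ∑-cong xs (λ x → ∑-cong (vecs xs m) (λ v → ∏-allFin-suc m (λ i → G i (lookup (x ∷ v) i)))) ⟩
  ∑ xs (λ x → ∑ (vecs xs m) (λ v → G zero x * ∏ (allFin m) (λ i → G (suc i) (lookup v i))))
    ≡⟨ ∑-cong xs (λ x → ∑-*ˡ (vecs xs m) (G zero x) _) ⟩
  ∑ xs (λ x → G zero x * ∑ (vecs xs m) (λ v → ∏ (allFin m) (λ i → G (suc i) (lookup v i))))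
    ≡⟨ ∑-*ʳ xs _ (G zero) ⟩
  ∑ xs (G zero) * ∑ (vecs xs m) (λ v → ∏ (allFin m) (λ i → G (suc i) (lookup v i)))
    ≡⟨ cong (∑ xs (G zero) *_) (∑-vecs-∏ xs m (G ∘ suc)) ⟩
  ∑ xs (G zero) * ∏ (allFin m) (λ i → ∑ xs (G (suc i)))
    ≡⟨ ∏-allFin-suc m (λ i → ∑ xs (G i)) ⟨
  ∏ (allFin (suc m)) (λ i → ∑ xs (G i)) ∎
  where open ≡-Reasoning

-- Invariance is a hypothesis on the entries so that the lemma can be applied twice: from bits to
-- rows, then from rows to matrices.
∑-vecs-translate : (xs : List A) (_∙_ : A → A → A) →
  (∀ a F → ∑ xs (λ x → F (x ∙ a)) ≡ ∑ xs F) →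
  ∀ m (v : Vec A m) F → ∑ (vecs xs m) (λ u → F (Vec.zipWith _∙_ u v)) ≡ ∑ (vecs xs m) F
∑-vecs-translate xs _∙_ inv zero    []      F = refl
∑-vecs-translate xs _∙_ inv (suc m) (a ∷ v) F = begin
  ∑ (vecs xs (suc m)) (λ u → F (Vec.zipWith _∙_ u (a ∷ v)))
    ≡⟨ ∑-vecs-suc xs m _ ⟩
  ∑ xs (λ x → ∑ (vecs xs m) (λ u → F ((x ∙ a) ∷ Vec.zipWith _∙_ u v)))
    ≡⟨ ∑-cong xs (λ x → ∑-vecs-translate xs _∙_ inv m v _) ⟩
  ∑ xs (λ x → ∑ (vecs xs m) (λ u → F ((x ∙ a) ∷ u)))
    ≡⟨ inv a (λ x → ∑ (vecs xs m) (λ u → F (x ∷ u))) ⟩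
  ∑ xs (λ x → ∑ (vecs xs m) (λ u → F (x ∷ u)))
    ≡⟨ ∑-vecs-suc xs m F ⟨
  ∑ (vecs xs (suc m)) F ∎
  where open ≡-Reasoning

-- Cochains and annihilators

⨁ : ∀ {n} → (Fin n → Bool) → Bool
⨁ {zero}  f = false
⨁ {suc n} f = f zero xor ⨁ (f ∘ suc)

⨁-cong : ∀ {n} {f g : Fin n → Bool} → (∀ i → f i ≡ g i) → ⨁ f ≡ ⨁ g
⨁-cong {zero}  h = refl
⨁-cong {suc n} h = cong₂ _xor_ (h zero) (⨁-cong (h ∘ suc))

⨁-xor : ∀ {n} (f g : Fin n → Bool) → ⨁ (λ i → f i xor g i) ≡ ⨁ f xor ⨁ g
⨁-xor {zero}  f g = refl
⨁-xor {suc n} f g = trans (cong ((f zero xor g zero) xor_) (⨁-xor (f ∘ suc) (g ∘ suc)))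
                          (xor-interchange (f zero) (g zero) _ _)

⨁-xor² : ∀ {n} (f g : Fin n → Fin n → Bool) →
         ⨁ (λ i → ⨁ (λ j → f i j xor g i j)) ≡ ⨁ (λ i → ⨁ (f i)) xor ⨁ (λ i → ⨁ (g i))
⨁-xor² f g = trans (⨁-cong (λ i → ⨁-xor (f i) (g i))) (⨁-xor (λ i → ⨁ (f i)) (λ i → ⨁ (g i)))

⨁-false : ∀ n → ⨁ {n} (λ _ → false) ≡ false
⨁-false zero    = refl
⨁-false (suc n) = ⨁-false n

⨁-∧ˡ : ∀ {n} b (f : Fin n → Bool) → ⨁ (λ i → b ∧ f i) ≡ b ∧ ⨁ f
⨁-∧ˡ {n} false f = ⨁-false n
⨁-∧ˡ true  f = refl

⨁-single : ∀ {n} (a : Fin n) (f : Fin n → Bool) → ⨁ (λ i → does (i ≟ a) ∧ f i) ≡ f a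
⨁-single {suc n} zero    f = trans (cong (f zero xor_) (⨁-false n)) (xor-identityʳ (f zero))
⨁-single {suc n} (suc a) f = ⨁-single a (f ∘ suc)

-- A 1-cochain is stored as an n × n matrix of which only the entries above the diagonal matter.
Cochain : ℕ → Set
Cochain n = Vec (Vec Bool n) n

entry : ∀ {n} → Cochain n → Fin n → Fin n → Bool
entry C i j = lookup (lookup C i) j

_⊞_ : ∀ {n} → Cochain n → Cochain n → Cochain n
_⊞_ = Vec.zipWith (Vec.zipWith _xor_)

entry-⊞ : ∀ {n} (C C′ : Cochain n) i j → entry (C ⊞ C′) i j ≡ entry C i j xor entry C′ i j
entry-⊞ C C′ i j = trans (cong (λ r → lookup r j) (lookup-zipWith (Vec.zipWith _xor_) i C C′))
                         (lookup-zipWith _xor_ j (lookup C i) (lookup C′ i))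

bools : List Bool
bools = false ∷ true ∷ []

cochains : ∀ n → List (Cochain n)
cochains n = vecs (vecs bools n) n

length-cochains : ∀ n → length (cochains n) ≡ 2 ^ (n * n)
length-cochains n = trans (length-vecs (vecs bools n) n)
  (trans (cong (_^ n) (length-vecs bools n)) (^-*-assoc 2 n n))

∑-bools-translate : ∀ b (F : Bool → ℕ) → ∑ bools (λ x → F (x xor b)) ≡ ∑ bools F
∑-bools-translate false F = refl
∑-bools-translate true  F = trans (cong (F true +_) (+-identityʳ (F false)))
  (trans (+-comm (F true) (F false)) (cong (F false +_) (sym (+-identityʳ (F true)))))

∑-cochains-translate : ∀ {n} (C₀ : Cochain n) F → ∑ (cochains n) (λ C → F (C ⊞ C₀)) ≡ ∑ (cochains n) F
∑-cochains-translate {n} = ∑-vecs-translate (vecs bools n) (Vec.zipWith _xor_)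
  (∑-vecs-translate bools _xor_ ∑-bools-translate n) n

-- The decision is an argument so that proofs about the pairing can split on it; it also supplies
-- the proof component of an `Edge n`.
term : ∀ {n} → Cochain n → Vec₂ (Edge n) → (i j : Fin n) → Dec (i <ᶠ j) → Bool
term C v i j (yes i<j) = entry C i j ∧ v (i , j , i<j)
term C v i j (no  _)   = false

⟨_,_⟩ : ∀ {n} → Cochain n → Vec₂ (Edge n) → Bool
⟨ C , v ⟩ = ⨁ (λ i → ⨁ (λ j → term C v i j (i <? j)))

⟨,⟩-cong : ∀ {n} (C : Cochain n) {u v : Vec₂ (Edge n)} → (∀ e → u e ≡ v e) → ⟨ C , u ⟩ ≡ ⟨ C , v ⟩
⟨,⟩-cong C {u} {v} h = ⨁-cong (λ i → ⨁-cong (λ j → go i j (i <? j)))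
  where
  go : ∀ i j d → term C u i j d ≡ term C v i j d
  go i j (yes i<j) = cong (entry C i j ∧_) (h (i , j , i<j))
  go i j (no  _)   = refl

⟨,⟩-+V : ∀ {n} (C : Cochain n) (u v : Vec₂ (Edge n)) → ⟨ C , u +V v ⟩ ≡ ⟨ C , u ⟩ xor ⟨ C , v ⟩
⟨,⟩-+V C u v = trans (⨁-cong (λ i → ⨁-cong (λ j → go i j (i <? j))))
  (⨁-xor² (λ i j → term C u i j (i <? j)) (λ i j → term C v i j (i <? j)))
  where
  go : ∀ i j d → term C (u +V v) i j d ≡ term C u i j d xor term C v i j d
  go i j (yes i<j) = ∧-distribˡ-xor (entry C i j) (u (i , j , i<j)) (v (i , j , i<j))
  go i j (no  _)   = refl

⟨,⟩-⊞ : ∀ {n} (C C′ : Cochain n) (v : Vec₂ (Edge n)) → ⟨ C ⊞ C′ , v ⟩ ≡ ⟨ C , v ⟩ xor ⟨ C′ , v ⟩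
⟨,⟩-⊞ C C′ v = trans (⨁-cong (λ i → ⨁-cong (λ j → go i j (i <? j))))
  (⨁-xor² (λ i j → term C v i j (i <? j)) (λ i j → term C′ v i j (i <? j)))
  where
  go : ∀ i j d → term (C ⊞ C′) v i j d ≡ term C v i j d xor term C′ v i j d
  go i j (yes i<j) = trans (cong (_∧ v (i , j , i<j)) (entry-⊞ C C′ i j))
                           (∧-distribʳ-xor (v (i , j , i<j)) (entry C i j) (entry C′ i j))
  go i j (no  _)   = refl

⟨,⟩-zero : ∀ {n} (C : Cochain n) {v : Vec₂ (Edge n)} → IsZero v → ⟨ C , v ⟩ ≡ false
⟨,⟩-zero {n} C {v} h = trans (⨁-cong (λ i → trans (⨁-cong (λ j → go i j (i <? j))) (⨁-false n))) (⨁-false n)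
  where
  go : ∀ i j d → term C v i j d ≡ false
  go i j (yes i<j) = trans (cong (entry C i j ∧_) (h (i , j , i<j))) (∧-zeroʳ _)
  go i j (no  _)   = refl

Kills : ∀ {n} → Cochain n → Vec₂ (Edge n) → Set
Kills C v = ⟨ C , v ⟩ ≡ false

kills-sumV : ∀ {n} (C : Cochain n) {vs} → All (Kills C) vs → Kills C (sumV vs)
kills-sumV C []                = ⟨,⟩-zero C (λ _ → refl)
kills-sumV C (_∷_ {v} {vs} k ks) = trans (⟨,⟩-+V C v (sumV vs)) (cong₂ _xor_ k (kills-sumV C ks))

-- Hence inserting v into an independent selection killed by C keeps it independent.
insert-unkilled : ∀ {n} (C : Cochain n) {ts vs v} → ts ⊆ vs → v ∈ vs → All (Kills C) ts → ⟨ C , v ⟩ ≡ true →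
  Σ[ us ∈ List (Vec₂ (Edge n)) ] (us ⊆ vs × length us ≡ suc (length ts) ×
    (∀ ss → ss ⊆ us → ss ⊆ ts ⊎ ⟨ C , sumV ss ⟩ ≡ true))
insert-unkilled C {ts} {v = v} (.v ∷ʳ τ) (here refl) ks h = v ∷ ts , refl ∷ τ , refl , split
  where
  split : ∀ ss → ss ⊆ v ∷ ts → ss ⊆ ts ⊎ ⟨ C , sumV ss ⟩ ≡ true
  split ss        (.v ∷ʳ ρ)  = inj₁ ρ
  split (.v ∷ ss) (refl ∷ ρ) = inj₂ (trans (⟨,⟩-+V C v (sumV ss)) (cong₂ _xor_ h (kills-sumV C (All-resp-⊆ ρ ks))))
insert-unkilled C (refl ∷ τ) (here refl) (k ∷ _) h = contradiction (trans (sym h) k) λ ()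
insert-unkilled C (y ∷ʳ τ) (there p) ks h =
  let us , us⊆vs , len , split = insert-unkilled C τ p ks h
  in us , y ∷ʳ us⊆vs , len , split
insert-unkilled C {t ∷ ts} (refl ∷ τ) (there p) (k ∷ ks) h =
  let us , us⊆vs , len , split = insert-unkilled C τ p ks h
      split′ : ∀ ss → ss ⊆ t ∷ us → ss ⊆ t ∷ ts ⊎ ⟨ C , sumV ss ⟩ ≡ true
      split′ = λ where
        ss (_ ∷ʳ ρ) → Sum.map₁ (t ∷ʳ_) (split ss ρ)
        (_ ∷ ss) (refl ∷ ρ) → Sum.map (refl ∷_)
          (λ q → trans (⟨,⟩-+V C t (sumV ss)) (cong₂ _xor_ k q)) (split ss ρ)
  in t ∷ us , refl ∷ us⊆vs , cong suc len , split′

-- No linear combination is ever solved for: a cochain killing `ts` but not `v` would itself certify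
-- that a longer selection is independent, against maximality.
kills-all : ∀ {n} (C : Cochain n) {ts vs} → ts ⊆ vs → Independent ts →
  (∀ us → us ⊆ vs → Independent us → length us ≤ length ts) →
  All (Kills C) ts → ∀ {v} → v ∈ vs → Kills C v
kills-all C {ts} τ ind max ks {v} v∈vs with ⟨ C , v ⟩ in h
... | false = refl
... | true with insert-unkilled C τ v∈vs ks h
...   | us , us⊆vs , len , split = contradiction (max us us⊆vs ind′) (subst (_≰ length ts) (sym len) 1+n≰n)
  where
  ind′ : Independent us
  ind′ ss ρ ss≢[] z with split ss ρ
  ... | inj₁ ρ′ = ind ss ρ′ ss≢[] z
  ... | inj₂ q  = contradiction (trans (sym q) (⟨,⟩-zero C z)) λ ()

-- Counting the cochains that kill a list of vectors

kills? : ∀ {n} → Cochain n → List (Vec₂ (Edge n)) → Bool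
kills? C []       = true
kills? C (v ∷ vs) = not ⟨ C , v ⟩ ∧ kills? C vs

kills?-sound : ∀ {n} (C : Cochain n) vs → kills? C vs ≡ true → All (Kills C) vs
kills?-sound C []       h = []
kills?-sound C (v ∷ vs) h with ⟨ C , v ⟩ in q
... | false = q ∷ kills?-sound C vs h

kills?-complete : ∀ {n} (C : Cochain n) vs → (∀ {v} → v ∈ vs → Kills C v) → kills? C vs ≡ true
kills?-complete C []       h = refl
kills?-complete C (v ∷ vs) h = cong₂ (λ a b → not a ∧ b) (h (here refl)) (kills?-complete C vs (h ∘ there))

kills?-⊞ : ∀ {n} (C C₀ : Cochain n) vs → kills? C₀ vs ≡ true → kills? (C ⊞ C₀) vs ≡ kills? C vs
kills?-⊞ C C₀ []       h = refl
kills?-⊞ C C₀ (v ∷ vs) h with ⟨ C₀ , v ⟩ in q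
... | false = cong₂ (λ a b → not a ∧ b)
  (trans (⟨,⟩-⊞ C C₀ v) (trans (cong (⟨ C , v ⟩ xor_) q) (xor-identityʳ _))) (kills?-⊞ C C₀ vs h)

annihilators : ∀ n → List (Vec₂ (Edge n)) → ℕ
annihilators n vs = ∑ (cochains n) (λ C → ι (kills? C vs))

∑-positive : {A : Set} (xs : List A) (f : A → Bool) →
             ∑ xs (ι ∘ f) ≡ 0 ⊎ Σ[ x ∈ A ] f x ≡ true
∑-positive []       f = inj₁ refl
∑-positive (x ∷ xs) f with f x in q
... | true  = inj₂ (x , q)
... | false = ∑-positive xs f

-- One linear condition at most halves the solution space. Either every cochain killing `vs` also
-- kills `v`, or translation by one that does not exchanges the two classes, which are then equally
-- large.
annihilators-∷ : ∀ {n} v vs → annihilators n vs ≤ 2 * annihilators n (v ∷ vs)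
annihilators-∷ {n} v vs = begin
  annihilators n vs
    ≡⟨ ∑-cong (cochains n) (λ C → split ⟨ C , v ⟩ (kills? C vs)) ⟩
  ∑ (cochains n) (λ C → ι (kills? C (v ∷ vs)) + ι (⟨ C , v ⟩ ∧ kills? C vs))
    ≡⟨ ∑-+ (cochains n) _ _ ⟩
  annihilators n (v ∷ vs) + unkilled
    ≤⟨ +-monoʳ-≤ (annihilators n (v ∷ vs)) unkilled≤ ⟩
  annihilators n (v ∷ vs) + annihilators n (v ∷ vs)
    ≡⟨ cong (annihilators n (v ∷ vs) +_) (+-identityʳ _) ⟨
  2 * annihilators n (v ∷ vs) ∎
  where
  open ≤-Reasoning
  unkilled = ∑ (cochains n) (λ C → ι (⟨ C , v ⟩ ∧ kills? C vs))
  split : ∀ a b → ι b ≡ ι (not a ∧ b) + ι (a ∧ b)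
  split false b = sym (+-identityʳ (ι b))
  split true  b = refl
  unkilled≤ : unkilled ≤ annihilators n (v ∷ vs)
  unkilled≤ with ∑-positive (cochains n) (λ C → ⟨ C , v ⟩ ∧ kills? C vs)
  ... | inj₁ none = ≤-trans (≤-reflexive none) z≤n
  ... | inj₂ (C₀ , q) with ⟨ C₀ , v ⟩ in qv | q
  ...   | true | qvs = ≤-reflexive (trans
    (sym (∑-cochains-translate C₀ (λ C → ι (⟨ C , v ⟩ ∧ kills? C vs))))
    (∑-cong (cochains n) (λ C → cong ι (cong₂ _∧_
       (trans (⟨,⟩-⊞ C C₀ v) (trans (cong (⟨ C , v ⟩ xor_) qv) (xor-comm ⟨ C , v ⟩ true)))
       (kills?-⊞ C C₀ vs qvs)))))

annihilators-length : ∀ n vs → 2 ^ (n * n) ≤ 2 ^ length vs * annihilators n vs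
annihilators-length n [] = ≤-reflexive (sym (trans (+-identityʳ _) (trans (sym (length-∑ (cochains n))) (length-cochains n))))
annihilators-length n (v ∷ vs) = begin
  2 ^ (n * n)                                  ≤⟨ annihilators-length n vs ⟩
  2 ^ length vs * annihilators n vs            ≤⟨ *-monoʳ-≤ (2 ^ length vs) (annihilators-∷ v vs) ⟩
  2 ^ length vs * (2 * annihilators n (v ∷ vs)) ≡⟨ *-assoc (2 ^ length vs) 2 _ ⟨
  2 ^ length vs * 2 * annihilators n (v ∷ vs)  ≡⟨ cong (_* annihilators n (v ∷ vs)) (*-comm (2 ^ length vs) 2) ⟩
  2 ^ length (v ∷ vs) * annihilators n (v ∷ vs) ∎
  where open ≤-Reasoning

ι-mono : ∀ {a b} → (a ≡ true → b ≡ true) → ι a ≤ ι b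
ι-mono {false} h = z≤n
ι-mono {true}  h rewrite h refl = ≤-refl

-- The half of rank-nullity that bounds the number of cocycles from below: conditions are counted on
-- a maximal independent selection, whose annihilators kill all of `vs` by `kills-all`.
annihilators-rank : ∀ n {vs r} → HasRank vs r → 2 ^ (n * n) ≤ 2 ^ r * annihilators n vs
annihilators-rank n {vs} ((ts , ts⊆vs , ind , refl) , max) = ≤-trans (annihilators-length n ts)
  (*-monoʳ-≤ (2 ^ length ts) (∑-mono (cochains n) (λ C → ι-mono (λ h →
    kills?-complete C vs (kills-all C ts⊆vs ind max (kills?-sound C ts h))))))

-- Pairing a cochain with the boundary of a triangle

value : ∀ {n} → Cochain n → Fin n → Fin n → Bool
value C u v = (does (u <? v) ∧ entry C u v) xor (does (v <? u) ∧ entry C v u)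

value-comm : ∀ {n} (C : Cochain n) u v → value C u v ≡ value C v u
value-comm C u v = xor-comm (does (u <? v) ∧ entry C u v) _

value-< : ∀ {n} (C : Cochain n) {u v} → u <ᶠ v → value C u v ≡ entry C u v
value-< C {u} {v} u<v rewrite dec-true (u <? v) u<v | dec-false (v <? u) (<-asym u<v) = xor-identityʳ (entry C u v)

isPair-sound : ∀ {n} {a b : Fin n} (e : Edge n) → isPair a b e ≡ true →
  (proj₁ e ≡ a × proj₁ (proj₂ e) ≡ b) ⊎ (proj₁ e ≡ b × proj₁ (proj₂ e) ≡ a)
isPair-sound {a = a} {b} (i , j , _) h with i ≟ a | j ≟ b | i ≟ b | j ≟ a
... | yes p | yes q | _     | _     = inj₁ (p , q)
... | yes _ | no  _ | yes p | yes q = inj₂ (p , q)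
... | no  _ | yes _ | yes p | yes q = inj₂ (p , q)
... | no  _ | no  _ | yes p | yes q = inj₂ (p , q)

⟨,isPair⟩-< : ∀ {n} (C : Cochain n) {a b} → a <ᶠ b → ⟨ C , isPair a b ⟩ ≡ entry C a b
⟨,isPair⟩-< C {a} {b} a<b = begin
  ⟨ C , isPair a b ⟩
    ≡⟨ ⨁-cong (λ i → trans (⨁-cong (λ j → go i j (i <? j))) (⨁-∧ˡ (does (i ≟ a)) (λ j → does (j ≟ b) ∧ entry C i j))) ⟩
  ⨁ (λ i → does (i ≟ a) ∧ ⨁ (λ j → does (j ≟ b) ∧ entry C i j))
    ≡⟨ ⨁-single a _ ⟩
  ⨁ (λ j → does (j ≟ b) ∧ entry C a j)
    ≡⟨ ⨁-single b _ ⟩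
  entry C a b ∎
  where
  open ≡-Reasoning
  go : ∀ i j d → term C (isPair a b) i j d ≡ does (i ≟ a) ∧ (does (j ≟ b) ∧ entry C i j)
  go i j (yes i<j) with i ≟ a | j ≟ b | i ≟ b | j ≟ a
  ... | yes _ | yes _ | _ | _ = ∧-identityʳ _
  ... | yes refl | no  _ | yes refl | _ = contradiction a<b (<-irrefl refl)
  ... | yes _ | no  _ | no _ | _ = ∧-zeroʳ _
  -- `isPair` also accepts the reversed pair, which `i<j` rules out.
  ... | no _ | _ | yes refl | yes refl = contradiction i<j (<-asym a<b)
  ... | no _ | yes _ | yes _ | no _ = ∧-zeroʳ _
  ... | no _ | no _ | yes _ | no _ = ∧-zeroʳ _
  ... | no _ | yes _ | no _ | _ = ∧-zeroʳ _
  ... | no _ | no _ | no _ | _ = ∧-zeroʳ _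
  go i j (no i≮j) with i ≟ a | j ≟ b
  ... | yes refl | yes refl = contradiction a<b i≮j
  ... | yes _    | no  _    = refl
  ... | no  _    | _        = refl

isPair-comm : ∀ {n} (a b : Fin n) e → isPair a b e ≡ isPair b a e
isPair-comm a b (i , j , _) = ∨-comm (⌊ i ≟ a ⌋ ∧ ⌊ j ≟ b ⌋) _

⟨,isPair⟩ : ∀ {n} (C : Cochain n) {a b} → a ≢ b → ⟨ C , isPair a b ⟩ ≡ value C a b
⟨,isPair⟩ C {a} {b} a≢b with <-cmp a b
... | tri< a<b _ _ = trans (⟨,isPair⟩-< C a<b) (sym (value-< C a<b))
... | tri≈ _ a≡b _ = contradiction a≡b a≢b
... | tri> _ _ b<a = trans (⟨,⟩-cong C (isPair-comm a b))
  (trans (⟨,isPair⟩-< C b<a) (sym (trans (value-comm C a b) (value-< C b<a))))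

∨≡xor : ∀ a b → (a ≡ true → b ≡ false) → a ∨ b ≡ a xor b
∨≡xor false b h = refl
∨≡xor true  b h rewrite h refl = refl

-- The boundary is built with `∨` while the pairing is additive for `xor`; for distinct vertices the
-- indicators of the three sides are disjoint, so the two agree.
⟨,∂₂⟩ : ∀ {n} (C : Cochain n) {u v w} → u ≢ v → w ≢ u → w ≢ v →
        ⟨ C , ∂₂ u v w ⟩ ≡ value C u v xor (value C u w xor value C v w)
⟨,∂₂⟩ C {u} {v} {w} u≢v w≢u w≢v = begin
  ⟨ C , ∂₂ u v w ⟩
    ≡⟨ ⟨,⟩-cong C ∂₂≡+V ⟩
  ⟨ C , isPair u v +V (isPair u w +V isPair v w) ⟩
    ≡⟨ trans (⟨,⟩-+V C _ _) (cong (⟨ C , isPair u v ⟩ xor_) (⟨,⟩-+V C _ _)) ⟩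
  ⟨ C , isPair u v ⟩ xor (⟨ C , isPair u w ⟩ xor ⟨ C , isPair v w ⟩)
    ≡⟨ cong₂ _xor_ (⟨,isPair⟩ C u≢v) (cong₂ _xor_ (⟨,isPair⟩ C (w≢u ∘ sym)) (⟨,isPair⟩ C (w≢v ∘ sym))) ⟩
  value C u v xor (value C u w xor value C v w) ∎
  where
  open ≡-Reasoning
  disjoint : ∀ {a b c} → a ≢ b → c ≢ a → c ≢ b → ∀ e → isPair a b e ≡ true → isPair a c e ≡ false
  disjoint {a} {b} {c} a≢b c≢a c≢b e@(i , j , _) p with isPair a c e in q
  ... | false = refl
  ... | true with isPair-sound {a = a} {b} e p | isPair-sound {a = a} {c} e q
  ...   | inj₁ (refl , refl) | inj₁ (_ , r) = contradiction (sym r) c≢b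
  ...   | inj₁ (refl , refl) | inj₂ (r , _) = contradiction (sym r) c≢a
  ...   | inj₂ (refl , refl) | inj₁ (r , _) = contradiction (sym r) a≢b
  ...   | inj₂ (refl , refl) | inj₂ (r , _) = contradiction (sym r) c≢b
  ∂₂≡+V : ∀ e → ∂₂ u v w e ≡ (isPair u v +V (isPair u w +V isPair v w)) e
  ∂₂≡+V e = trans
    (∨≡xor (isPair u v e) _ (λ p → cong₂ _∨_ (disjoint u≢v w≢u w≢v e p)
      (disjoint (u≢v ∘ sym) w≢v w≢u e (trans (isPair-comm v u e) p))))
    (cong (isPair u v e xor_) (∨≡xor (isPair u w e) _ (λ p →
      trans (isPair-comm v w e) (disjoint w≢u (w≢v ∘ sym) (u≢v ∘ sym) e (trans (isPair-comm w u e) p)))))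

-- The variance of a sample with replacement

∑ᶻ : List A → (A → ℤ) → ℤ
∑ᶻ []       f = 0ℤ
∑ᶻ (x ∷ xs) f = f x +ᶻ ∑ᶻ xs f

∑ᶻ-cong : (xs : List A) {f g : A → ℤ} → (∀ x → f x ≡ g x) → ∑ᶻ xs f ≡ ∑ᶻ xs g
∑ᶻ-cong []       h = refl
∑ᶻ-cong (x ∷ xs) h = cong₂ _+ᶻ_ (h x) (∑ᶻ-cong xs h)

∑ᶻ-mono : (xs : List A) {f g : A → ℤ} → (∀ x → f x ≤ᶻ g x) → ∑ᶻ xs f ≤ᶻ ∑ᶻ xs g
∑ᶻ-mono []       h = ℤ.≤-refl
∑ᶻ-mono (x ∷ xs) h = ℤ.+-mono-≤ (h x) (∑ᶻ-mono xs h)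

∑ᶻ-*ˡ : (xs : List A) (c : ℤ) (f : A → ℤ) → ∑ᶻ xs (λ x → c *ᶻ f x) ≡ c *ᶻ ∑ᶻ xs f
∑ᶻ-*ˡ []       c f = sym (ℤ.*-zeroʳ c)
∑ᶻ-*ˡ (x ∷ xs) c f = trans (cong (c *ᶻ f x +ᶻ_) (∑ᶻ-*ˡ xs c f)) (sym (ℤ.*-distribˡ-+ c (f x) (∑ᶻ xs f)))

∑ᶻ-++ : (xs ys : List A) (f : A → ℤ) → ∑ᶻ (xs ++ ys) f ≡ ∑ᶻ xs f +ᶻ ∑ᶻ ys f
∑ᶻ-++ []       ys f = sym (ℤ.+-identityˡ _)
∑ᶻ-++ (x ∷ xs) ys f = trans (cong (f x +ᶻ_) (∑ᶻ-++ xs ys f)) (sym (ℤ.+-assoc (f x) _ _))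

∑ᶻ-map : (g : A → B) (xs : List A) (f : B → ℤ) → ∑ᶻ (map g xs) f ≡ ∑ᶻ xs (f ∘ g)
∑ᶻ-map g []       f = refl
∑ᶻ-map g (x ∷ xs) f = cong (f (g x) +ᶻ_) (∑ᶻ-map g xs f)

∑ᶻ-concatMap : (g : A → List B) (xs : List A) (f : B → ℤ) →
               ∑ᶻ (concatMap g xs) f ≡ ∑ᶻ xs (λ x → ∑ᶻ (g x) f)
∑ᶻ-concatMap g []       f = refl
∑ᶻ-concatMap g (x ∷ xs) f = trans (∑ᶻ-++ (g x) (concatMap g xs) f) (cong (∑ᶻ (g x) f +ᶻ_) (∑ᶻ-concatMap g xs f))

∑ᶻ-pos : (xs : List A) (f : A → ℕ) → ∑ᶻ xs (λ x → ⁺ f x) ≡ ⁺ ∑ xs f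
∑ᶻ-pos []       f = refl
∑ᶻ-pos (x ∷ xs) f = cong (⁺ f x +ᶻ_) (∑ᶻ-pos xs f)

∑ᶻ-affine : (xs : List A) (a b : ℤ) (f : A → ℤ) →
            ∑ᶻ xs (λ x → a *ᶻ f x +ᶻ b) ≡ a *ᶻ ∑ᶻ xs f +ᶻ ⁺ length xs *ᶻ b
∑ᶻ-affine []       a b f = identity a b
  where
  identity : ∀ a b → 0ℤ ≡ a *ᶻ 0ℤ +ᶻ 0ℤ *ᶻ b
  identity = ℤ-solve-∀
∑ᶻ-affine (x ∷ xs) a b f = trans (cong (a *ᶻ f x +ᶻ b +ᶻ_) (∑ᶻ-affine xs a b f))
  (identity a b (f x) (∑ᶻ xs f) (⁺ length xs))
  where
  identity : ∀ a b y s l → a *ᶻ y +ᶻ b +ᶻ (a *ᶻ s +ᶻ l *ᶻ b) ≡ a *ᶻ (y +ᶻ s) +ᶻ (⁺ 1 +ᶻ l) *ᶻ b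
  identity = ℤ-solve-∀

∑ᶻ-shifted-squares : (xs : List A) (c : ℤ) (y : A → ℤ) →
  ∑ᶻ xs (λ x → (c +ᶻ y x) *ᶻ (c +ᶻ y x)) ≡ ⁺ length xs *ᶻ (c *ᶻ c) +ᶻ ⁺ 2 *ᶻ c *ᶻ ∑ᶻ xs y +ᶻ ∑ᶻ xs (λ x → y x *ᶻ y x)
∑ᶻ-shifted-squares []       c y = identity c
  where
  identity : ∀ c → 0ℤ ≡ 0ℤ *ᶻ (c *ᶻ c) +ᶻ ⁺ 2 *ᶻ c *ᶻ 0ℤ +ᶻ 0ℤ
  identity = ℤ-solve-∀
∑ᶻ-shifted-squares (x ∷ xs) c y = trans (cong ((c +ᶻ y x) *ᶻ (c +ᶻ y x) +ᶻ_) (∑ᶻ-shifted-squares xs c y))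
  (identity c (y x) (∑ᶻ xs y) (∑ᶻ xs (λ x → y x *ᶻ y x)) (⁺ length xs))
  where
  identity : ∀ c y s q l → (c +ᶻ y) *ᶻ (c +ᶻ y) +ᶻ (l *ᶻ (c *ᶻ c) +ᶻ ⁺ 2 *ᶻ c *ᶻ s +ᶻ q) ≡
                           (⁺ 1 +ᶻ l) *ᶻ (c *ᶻ c) +ᶻ ⁺ 2 *ᶻ c *ᶻ (y +ᶻ s) +ᶻ (y *ᶻ y +ᶻ q)
  identity = ℤ-solve-∀

∑ᶻ-vecs-suc : (xs : List A) (m : ℕ) (F : Vec A (suc m) → ℤ) →
              ∑ᶻ (vecs xs (suc m)) F ≡ ∑ᶻ xs (λ x → ∑ᶻ (vecs xs m) (λ v → F (x ∷ v)))
∑ᶻ-vecs-suc xs m F = trans (∑ᶻ-concatMap (λ x → map (x ∷_) (vecs xs m)) xs F)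
                           (∑ᶻ-cong xs (λ x → ∑ᶻ-map (x ∷_) (vecs xs m) F))

-- Induction on the sample size absorbs the first draw into the shift `c`, which is why the shift is
-- general. The cross term vanishes because `y` has mean zero; the factor `length xs` on the left
-- avoids a power with exponent `K - 1`.
sample-variance : (xs : List A) (y : A → ℤ) → ∑ᶻ xs y ≡ 0ℤ → ∀ K c →
  ⁺ length xs *ᶻ ∑ᶻ (vecs xs K) (λ z → (c +ᶻ ∑ᶻ (toList z) y) *ᶻ (c +ᶻ ∑ᶻ (toList z) y)) ≡
  ⁺ (length xs ^ K) *ᶻ (⁺ length xs *ᶻ (c *ᶻ c) +ᶻ ⁺ K *ᶻ ∑ᶻ xs (λ x → y x *ᶻ y x))
sample-variance xs y mean zero c = identity (⁺ length xs) c (∑ᶻ xs (λ x → y x *ᶻ y x))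
  where
  identity : ∀ l c q → l *ᶻ ((c +ᶻ 0ℤ) *ᶻ (c +ᶻ 0ℤ) +ᶻ 0ℤ) ≡ ⁺ 1 *ᶻ (l *ᶻ (c *ᶻ c) +ᶻ 0ℤ *ᶻ q)
  identity = ℤ-solve-∀
sample-variance xs y mean (suc K) c = begin
  l *ᶻ ∑ᶻ (vecs xs (suc K)) (λ z → sq (c +ᶻ ∑ᶻ (toList z) y))
    ≡⟨ cong (l *ᶻ_) (∑ᶻ-vecs-suc xs K _) ⟩
  l *ᶻ ∑ᶻ xs (λ x → ∑ᶻ (vecs xs K) (λ z → sq (c +ᶻ (y x +ᶻ ∑ᶻ (toList z) y))))
    ≡⟨ ∑ᶻ-*ˡ xs l _ ⟨
  ∑ᶻ xs (λ x → l *ᶻ ∑ᶻ (vecs xs K) (λ z → sq (c +ᶻ (y x +ᶻ ∑ᶻ (toList z) y))))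
    ≡⟨ ∑ᶻ-cong xs (λ x → cong (l *ᶻ_) (∑ᶻ-cong (vecs xs K) (λ z → cong sq (sym (ℤ.+-assoc c (y x) _))))) ⟩
  ∑ᶻ xs (λ x → l *ᶻ ∑ᶻ (vecs xs K) (λ z → sq (c +ᶻ y x +ᶻ ∑ᶻ (toList z) y)))
    ≡⟨ ∑ᶻ-cong xs (λ x → sample-variance xs y mean K (c +ᶻ y x)) ⟩
  ∑ᶻ xs (λ x → p *ᶻ (l *ᶻ sq (c +ᶻ y x) +ᶻ ⁺ K *ᶻ q))
    ≡⟨ ∑ᶻ-*ˡ xs p _ ⟩
  p *ᶻ ∑ᶻ xs (λ x → l *ᶻ sq (c +ᶻ y x) +ᶻ ⁺ K *ᶻ q)
    ≡⟨ cong (p *ᶻ_) (∑ᶻ-affine xs l (⁺ K *ᶻ q) _) ⟩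
  p *ᶻ (l *ᶻ ∑ᶻ xs (λ x → sq (c +ᶻ y x)) +ᶻ l *ᶻ (⁺ K *ᶻ q))
    ≡⟨ cong (λ t → p *ᶻ (l *ᶻ t +ᶻ l *ᶻ (⁺ K *ᶻ q)))
         (trans (∑ᶻ-shifted-squares xs c y) (cong (λ s → l *ᶻ (c *ᶻ c) +ᶻ ⁺ 2 *ᶻ c *ᶻ s +ᶻ q) mean)) ⟩
  p *ᶻ (l *ᶻ (l *ᶻ (c *ᶻ c) +ᶻ ⁺ 2 *ᶻ c *ᶻ 0ℤ +ᶻ q) +ᶻ l *ᶻ (⁺ K *ᶻ q))
    ≡⟨ identity p l c q (⁺ K) ⟩
  l *ᶻ p *ᶻ (l *ᶻ (c *ᶻ c) +ᶻ (⁺ 1 +ᶻ ⁺ K) *ᶻ q)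
    ≡⟨ cong (_*ᶻ (l *ᶻ (c *ᶻ c) +ᶻ ⁺ suc K *ᶻ q)) (ℤ.pos-* (length xs) (length xs ^ K)) ⟨
  ⁺ (length xs ^ suc K) *ᶻ (l *ᶻ (c *ᶻ c) +ᶻ ⁺ suc K *ᶻ q) ∎
  where
  open ≡-Reasoning
  sq : ℤ → ℤ
  sq i = i *ᶻ i
  l = ⁺ length xs
  p = ⁺ (length xs ^ K)
  q = ∑ᶻ xs (λ x → y x *ᶻ y x)
  identity : ∀ p l c q k → p *ᶻ (l *ᶻ (l *ᶻ (c *ᶻ c) +ᶻ ⁺ 2 *ᶻ c *ᶻ 0ℤ +ᶻ q) +ᶻ l *ᶻ (k *ᶻ q)) ≡
                           l *ᶻ p *ᶻ (l *ᶻ (c *ᶻ c) +ᶻ (⁺ 1 +ᶻ k) *ᶻ q)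
  identity = ℤ-solve-∀

∑-ι≤length : (xs : List A) (x : A → Bool) → ∑ xs (ι ∘ x) ≤ length xs
∑-ι≤length xs x = ≤-trans (∑-mono xs (λ a → ι≤1 (x a))) (≤-reflexive (sym (length-∑ xs)))
  where
  ι≤1 : ∀ b → ι b ≤ 1
  ι≤1 false = z≤n
  ι≤1 true  = ≤-refl

i*i≡+∣i∣*∣i∣ : ∀ i → i *ᶻ i ≡ ⁺ (∣ i ∣ * ∣ i ∣)
i*i≡+∣i∣*∣i∣ (⁺ n)    = sym (ℤ.pos-* n n)
i*i≡+∣i∣*∣i∣ -[1+ n ] = refl

module Chebyshev (xs : List A) (x : A → Bool) (D K : ℕ) where
  l = length xs
  μ = ∑ xs (ι ∘ x)

  hits : Vec A K → ℕ
  hits z = ∑ (toList z) (ι ∘ x)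

  -- The sample z underestimates the frequency μ / l by more than 1 / D.
  bad : Vec A K → Bool
  bad z = does (l * (D * hits z + K) ℕ.<? D * K * μ)

  -- The centred indicator, multiplied by `l` to stay integral.
  deviation : A → ℤ
  deviation a = ⁺ l *ᶻ ⁺ ι (x a) +ᶻ -ᶻ (⁺ μ)

  ∑-deviation : (ys : List A) → ∑ᶻ ys deviation ≡ ⁺ l *ᶻ ⁺ ∑ ys (ι ∘ x) +ᶻ ⁺ length ys *ᶻ -ᶻ (⁺ μ)
  ∑-deviation ys = trans (∑ᶻ-affine ys (⁺ l) (-ᶻ (⁺ μ)) _)
    (cong (λ t → ⁺ l *ᶻ t +ᶻ ⁺ length ys *ᶻ -ᶻ (⁺ μ)) (∑ᶻ-pos ys (ι ∘ x)))

  deviation-mean : ∑ᶻ xs deviation ≡ 0ℤ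
  deviation-mean = trans (∑-deviation xs) (identity (⁺ l) (⁺ μ))
    where
    identity : ∀ l m → l *ᶻ m +ᶻ l *ᶻ -ᶻ m ≡ 0ℤ
    identity = ℤ-solve-∀

  -- In absolute value the deviation is `l - μ` or `μ`, since `μ ≤ l`. This crude variance bound is
  -- enough.
  deviation-square : ∀ a → deviation a *ᶻ deviation a ≤ᶻ ⁺ (l * l)
  deviation-square a with m≤n⇒∃[o]m+o≡n (∑-ι≤length xs x) | x a
  ... | r , eq | true  = subst (_≤ᶻ ⁺ (l * l)) (sym (begin
      (⁺ l *ᶻ ⁺ 1 +ᶻ -ᶻ (⁺ μ)) *ᶻ (⁺ l *ᶻ ⁺ 1 +ᶻ -ᶻ (⁺ μ))
        ≡⟨ cong (λ t → (t *ᶻ ⁺ 1 +ᶻ -ᶻ (⁺ μ)) *ᶻ (t *ᶻ ⁺ 1 +ᶻ -ᶻ (⁺ μ))) (trans (cong ⁺_ (sym eq)) (ℤ.pos-+ μ r)) ⟩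
      ((⁺ μ +ᶻ ⁺ r) *ᶻ ⁺ 1 +ᶻ -ᶻ (⁺ μ)) *ᶻ ((⁺ μ +ᶻ ⁺ r) *ᶻ ⁺ 1 +ᶻ -ᶻ (⁺ μ))
        ≡⟨ identity (⁺ μ) (⁺ r) ⟩
      ⁺ r *ᶻ ⁺ r
        ≡⟨ ℤ.pos-* r r ⟨
      ⁺ (r * r) ∎)) (+≤+ (*-mono-≤ r≤l r≤l))
    where
    open ≡-Reasoning
    r≤l : r ≤ l
    r≤l = subst (r ≤_) eq (m≤n+m r μ)
    identity : ∀ m r → ((m +ᶻ r) *ᶻ ⁺ 1 +ᶻ -ᶻ m) *ᶻ ((m +ᶻ r) *ᶻ ⁺ 1 +ᶻ -ᶻ m) ≡ r *ᶻ r
    identity = ℤ-solve-∀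
  ... | r , eq | false = subst (_≤ᶻ ⁺ (l * l)) (sym (trans (identity (⁺ l) (⁺ μ)) (sym (ℤ.pos-* μ μ))))
      (+≤+ (*-mono-≤ (∑-ι≤length xs x) (∑-ι≤length xs x)))
    where
    identity : ∀ l m → (l *ᶻ 0ℤ +ᶻ -ᶻ m) *ᶻ (l *ᶻ 0ℤ +ᶻ -ᶻ m) ≡ m *ᶻ m
    identity = ℤ-solve-∀

  -- On a bad sample, `D` times the sum of the deviations is `-(l * K + e)`, where `e` is the slack
  -- in the inequality defining `bad`; squaring gives the bound. On the other samples the left side
  -- is 0.
  bad-deviation : ∀ z → ⁺ (ι (bad z) * (l * K * (l * K))) ≤ᶻ
    ⁺ (D * D) *ᶻ ((0ℤ +ᶻ ∑ᶻ (toList z) deviation) *ᶻ (0ℤ +ᶻ ∑ᶻ (toList z) deviation))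
  bad-deviation z = go (l * (D * hits z + K) ℕ.<? D * K * μ)
    where
    open ≡-Reasoning
    S = 0ℤ +ᶻ ∑ᶻ (toList z) deviation
    h = hits z
    eqᶻ : ∀ e → l * (D * h + K) + e ≡ D * K * μ → ⁺ D *ᶻ ⁺ K *ᶻ ⁺ μ ≡ ⁺ l *ᶻ (⁺ D *ᶻ ⁺ h +ᶻ ⁺ K) +ᶻ ⁺ e
    eqᶻ e eq = begin
      ⁺ D *ᶻ ⁺ K *ᶻ ⁺ μ                    ≡⟨ cong (_*ᶻ ⁺ μ) (ℤ.pos-* D K) ⟨
      ⁺ (D * K) *ᶻ ⁺ μ                     ≡⟨ ℤ.pos-* (D * K) μ ⟨
      ⁺ (D * K * μ)                        ≡⟨ cong ⁺_ eq ⟨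
      ⁺ (l * (D * h + K) + e)              ≡⟨ cong (_+ᶻ ⁺ e) (ℤ.pos-* l (D * h + K)) ⟩
      ⁺ l *ᶻ ⁺ (D * h + K) +ᶻ ⁺ e          ≡⟨ cong (λ t → ⁺ l *ᶻ (t +ᶻ ⁺ K) +ᶻ ⁺ e) (ℤ.pos-* D h) ⟩
      ⁺ l *ᶻ (⁺ D *ᶻ ⁺ h +ᶻ ⁺ K) +ᶻ ⁺ e    ∎
    regroup : ∀ d k m l b → d *ᶻ d *ᶻ ((0ℤ +ᶻ (l *ᶻ b +ᶻ k *ᶻ -ᶻ m)) *ᶻ (0ℤ +ᶻ (l *ᶻ b +ᶻ k *ᶻ -ᶻ m))) ≡
                            (d *ᶻ (l *ᶻ b) +ᶻ -ᶻ (d *ᶻ k *ᶻ m)) *ᶻ (d *ᶻ (l *ᶻ b) +ᶻ -ᶻ (d *ᶻ k *ᶻ m))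
    regroup = ℤ-solve-∀
    simplify : ∀ d k l b e → (d *ᶻ (l *ᶻ b) +ᶻ -ᶻ (l *ᶻ (d *ᶻ b +ᶻ k) +ᶻ e)) *ᶻ (d *ᶻ (l *ᶻ b) +ᶻ -ᶻ (l *ᶻ (d *ᶻ b +ᶻ k) +ᶻ e)) ≡
                             (l *ᶻ k +ᶻ e) *ᶻ (l *ᶻ k +ᶻ e)
    simplify = ℤ-solve-∀
    sum≡ : ∑ᶻ (toList z) deviation ≡ ⁺ l *ᶻ ⁺ h +ᶻ ⁺ K *ᶻ -ᶻ (⁺ μ)
    sum≡ = trans (∑-deviation (toList z)) (cong (λ k → ⁺ l *ᶻ ⁺ h +ᶻ ⁺ k *ᶻ -ᶻ (⁺ μ)) (length-toList z))
    square : ∀ e → l * (D * h + K) + e ≡ D * K * μ → ⁺ (D * D) *ᶻ (S *ᶻ S) ≡ ⁺ ((l * K + e) * (l * K + e))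
    square e eq = begin
      _ ≡⟨ cong₂ (λ d s → d *ᶻ ((0ℤ +ᶻ s) *ᶻ (0ℤ +ᶻ s))) (ℤ.pos-* D D) sum≡ ⟩
      _ ≡⟨ regroup (⁺ D) (⁺ K) (⁺ μ) (⁺ l) (⁺ h) ⟩
      _ ≡⟨ cong (λ t → (⁺ D *ᶻ (⁺ l *ᶻ ⁺ h) +ᶻ -ᶻ t) *ᶻ (⁺ D *ᶻ (⁺ l *ᶻ ⁺ h) +ᶻ -ᶻ t)) (eqᶻ e eq) ⟩
      _ ≡⟨ simplify (⁺ D) (⁺ K) (⁺ l) (⁺ h) (⁺ e) ⟩
      _ ≡⟨ cong (λ t → (t +ᶻ ⁺ e) *ᶻ (t +ᶻ ⁺ e)) (ℤ.pos-* l K) ⟨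
      ⁺ (l * K + e) *ᶻ ⁺ (l * K + e) ≡⟨ ℤ.pos-* (l * K + e) (l * K + e) ⟨
      ⁺ ((l * K + e) * (l * K + e)) ∎
    go : (d : Dec (l * (D * h + K) < D * K * μ)) → ⁺ (ι (does d) * (l * K * (l * K))) ≤ᶻ ⁺ (D * D) *ᶻ (S *ᶻ S)
    go (no  _)  = subst (0ℤ ≤ᶻ_)
      (trans (ℤ.pos-* (D * D) _) (cong (⁺ (D * D) *ᶻ_) (sym (i*i≡+∣i∣*∣i∣ S)))) (+≤+ z≤n)
    go (yes lt) = let e , eq = m≤n⇒∃[o]m+o≡n (<⇒≤ lt) in
      subst (⁺ (1 * (l * K * (l * K))) ≤ᶻ_) (sym (square e eq))
        (+≤+ (≤-trans (≤-reflexive (*-identityˡ _)) (*-mono-≤ (m≤m+n (l * K) e) (m≤m+n (l * K) e))))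

  bads : ℕ
  bads = ∑ (vecs xs K) (ι ∘ bad)

  bads-scaled : l * (bads * (l * K * (l * K))) ≤ D * D * (l ^ K * (K * (l * (l * l))))
  bads-scaled = ℤ.drop‿+≤+ (begin
    ⁺ (l * (bads * q))
      ≡⟨ trans (ℤ.pos-* l _) (cong (λ t → ⁺ l *ᶻ ⁺ t) (sym (∑-*ʳ (vecs xs K) q (ι ∘ bad)))) ⟩
    ⁺ l *ᶻ ⁺ ∑ (vecs xs K) (λ z → ι (bad z) * q)
      ≡⟨ cong (⁺ l *ᶻ_) (∑ᶻ-pos (vecs xs K) _) ⟨
    ⁺ l *ᶻ ∑ᶻ (vecs xs K) (λ z → ⁺ (ι (bad z) * q))
      ≤⟨ ℤ.*-monoˡ-≤-nonNeg (⁺ l) (∑ᶻ-mono (vecs xs K) bad-deviation) ⟩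
    ⁺ l *ᶻ ∑ᶻ (vecs xs K) (λ z → ⁺ (D * D) *ᶻ sq z)
      ≡⟨ cong (⁺ l *ᶻ_) (∑ᶻ-*ˡ (vecs xs K) (⁺ (D * D)) sq) ⟩
    ⁺ l *ᶻ (⁺ (D * D) *ᶻ ∑ᶻ (vecs xs K) sq)
      ≡⟨ swap (⁺ l) (⁺ (D * D)) _ ⟩
    ⁺ (D * D) *ᶻ (⁺ l *ᶻ ∑ᶻ (vecs xs K) sq)
      ≡⟨ cong (⁺ (D * D) *ᶻ_) (sample-variance xs deviation deviation-mean K 0ℤ) ⟩
    ⁺ (D * D) *ᶻ (⁺ (l ^ K) *ᶻ (⁺ l *ᶻ (0ℤ *ᶻ 0ℤ) +ᶻ ⁺ K *ᶻ V))
      ≡⟨ cong (λ t → ⁺ (D * D) *ᶻ (⁺ (l ^ K) *ᶻ t)) (drop-zero (⁺ l) (⁺ K *ᶻ V)) ⟩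
    ⁺ (D * D) *ᶻ (⁺ (l ^ K) *ᶻ (⁺ K *ᶻ V))
      ≤⟨ ℤ.*-monoˡ-≤-nonNeg (⁺ (D * D)) (ℤ.*-monoˡ-≤-nonNeg (⁺ (l ^ K)) (ℤ.*-monoˡ-≤-nonNeg (⁺ K) V≤)) ⟩
    ⁺ (D * D) *ᶻ (⁺ (l ^ K) *ᶻ (⁺ K *ᶻ ⁺ (l * (l * l))))
      ≡⟨ cong (λ t → ⁺ (D * D) *ᶻ (⁺ (l ^ K) *ᶻ t)) (ℤ.pos-* K _) ⟨
    ⁺ (D * D) *ᶻ (⁺ (l ^ K) *ᶻ ⁺ (K * (l * (l * l))))
      ≡⟨ cong (⁺ (D * D) *ᶻ_) (ℤ.pos-* (l ^ K) _) ⟨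
    ⁺ (D * D) *ᶻ ⁺ (l ^ K * (K * (l * (l * l))))
      ≡⟨ ℤ.pos-* (D * D) _ ⟨
    ⁺ (D * D * (l ^ K * (K * (l * (l * l))))) ∎)
    where
    open ℤ.≤-Reasoning
    q = l * K * (l * K)
    sq : Vec A K → ℤ
    sq z = (0ℤ +ᶻ ∑ᶻ (toList z) deviation) *ᶻ (0ℤ +ᶻ ∑ᶻ (toList z) deviation)
    V = ∑ᶻ xs (λ a → deviation a *ᶻ deviation a)
    V≤ : V ≤ᶻ ⁺ (l * (l * l))
    V≤ = ℤ.≤-trans (∑ᶻ-mono xs deviation-square)
      (ℤ.≤-reflexive (trans (∑ᶻ-pos xs (λ _ → l * l)) (cong ⁺_ (∑-const xs (l * l)))))
    swap : ∀ a b c → a *ᶻ (b *ᶻ c) ≡ b *ᶻ (a *ᶻ c)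
    swap = ℤ-solve-∀
    drop-zero : ∀ a b → a *ᶻ (0ℤ *ᶻ 0ℤ) +ᶻ b ≡ b
    drop-zero = ℤ-solve-∀

  chebyshev : 0 < l → 0 < K → bads * K ≤ D * D * l ^ K
  chebyshev 0<l 0<K = *-cancelʳ-≤ _ _ (l * l * l * K)
    (subst₂ _≤_ (left l K bads) (right l K (D * D) (l ^ K)) bads-scaled)
    where
    instance
      l≢0 : NonZero l
      l≢0 = >-nonZero 0<l
      K≢0 : NonZero K
      K≢0 = >-nonZero 0<K
      ll≢0 = m*n≢0 l l
      lll≢0 = m*n≢0 (l * l) l
      lllK≢0 = m*n≢0 (l * l * l) K
    left : ∀ l k b → l * (b * (l * k * (l * k))) ≡ b * k * (l * l * l * k)
    left = ℕ-solve-∀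
    right : ∀ l k d p → d * (p * (k * (l * (l * l)))) ≡ d * p * (l * l * l * k)
    right = ℕ-solve-∀

-- The expected number of cocycles

edge-< : ∀ {n u v} → (u , v) ∈ edges n → u <ᶠ v
edge-< {n} uv∈ with find (∈-concatMap⁻ (λ i → map (λ j → (i , j)) (filter (i <?_) (allFin n))) {xs = allFin n} uv∈)
... | i , _ , p with ∈-map⁻ _ p
...   | j , q , refl = proj₂ (∈-filter⁻ (i <?_) {xs = allFin n} q)

edge-≢ : ∀ {n} {u v : Fin n} → (u , v) ∈ edges n → u ≢ v
edge-≢ uv∈ u≡v = <-irrefl u≡v (edge-< uv∈)

-- The filler 1 off the edge set lets the product range over all matrix positions, the shape that
-- `∑-vecs-∏` handles.
∏-edges : ∀ n (f : Fin n × Fin n → ℕ) →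
  ∏ (edges n) f ≡ ∏ (allFin n) (λ i → ∏ (allFin n) (λ j → if does (i <? j) then f (i , j) else 1))
∏-edges n f = trans (∏-concatMap _ (allFin n) f) (∏-cong (allFin n) (λ i →
  trans (∏-map _ (filter (i <?_) (allFin n)) f) (∏-filter (i <?_) (allFin n) _)))

∏²-* : ∀ n (f g : Fin n → Fin n → ℕ) →
  ∏ (allFin n) (λ i → ∏ (allFin n) (f i)) * ∏ (allFin n) (λ i → ∏ (allFin n) (g i)) ≡
  ∏ (allFin n) (λ i → ∏ (allFin n) (λ j → f i j * g i j))
∏²-* n f g = sym (trans (∏-cong (allFin n) (λ i → ∏-* (allFin n) (f i) (g i))) (∏-* (allFin n) _ _))

∏²-const : ∀ n c → ∏ (allFin n) (λ _ → ∏ (allFin n) (λ _ → c)) ≡ c ^ (n * n)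
∏²-const n c = begin
  ∏ (allFin n) (λ _ → ∏ (allFin n) (λ _ → c)) ≡⟨ ∏-const (allFin n) _ ⟩
  ∏ (allFin n) (λ _ → c) ^ length (allFin n)  ≡⟨ cong₂ _^_ (∏-const (allFin n) c) (length-allFin n) ⟩
  (c ^ length (allFin n)) ^ n                 ≡⟨ cong (λ l → (c ^ l) ^ n) (length-allFin n) ⟩
  (c ^ n) ^ n                                 ≡⟨ ^-*-assoc c n n ⟩
  c ^ (n * n)                                 ∎
  where open ≡-Reasoning

-- Entries on or below the diagonal are free; multiplying by 2 ^ ∣edges∣ avoids subtracting their number.
∑-cochains-∏ : ∀ n (G : Fin n → Fin n → Bool → ℕ) y → (∀ i j → G i j false + G i j true ≡ y) →
  ∑ (cochains n) (λ C → ∏ (edges n) (λ (i , j) → G i j (entry C i j))) * 2 ^ length (edges n) ≡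
  2 ^ (n * n) * y ^ length (edges n)
∑-cochains-∏ n G y G≡y = begin
  ∑ (cochains n) (λ C → ∏ (edges n) (λ (i , j) → G i j (entry C i j))) * 2 ^ length (edges n)
    ≡⟨ cong₂ _*_ (∑-cong (cochains n) (λ C → ∏-edges n _)) (sym (∏-const (edges n) 2)) ⟩
  ∑ (cochains n) (λ C → ∏ (allFin n) (λ i → ∏ (allFin n) (λ j → H i j (entry C i j)))) * ∏ (edges n) (λ _ → 2)
    ≡⟨ cong₂ _*_ (∑-vecs-∏ (vecs bools n) n (λ i r → ∏ (allFin n) (λ j → H i j (lookup r j)))) (∏-edges n _) ⟩
  ∏ (allFin n) (λ i → ∑ (vecs bools n) (λ r → ∏ (allFin n) (λ j → H i j (lookup r j)))) * twos
    ≡⟨ cong (_* twos) (∏-cong (allFin n) (λ i → ∑-vecs-∏ bools n (H i))) ⟩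
  ∏ (allFin n) (λ i → ∏ (allFin n) (λ j → ∑ bools (H i j))) * twos
    ≡⟨ ∏²-* n _ _ ⟩
  ∏ (allFin n) (λ i → ∏ (allFin n) (λ j → ∑ bools (H i j) * (if does (i <? j) then 2 else 1)))
    ≡⟨ ∏-cong (allFin n) (λ i → ∏-cong (allFin n) (λ j → pointwise i j (does (i <? j)))) ⟩
  ∏ (allFin n) (λ i → ∏ (allFin n) (λ j → 2 * (if does (i <? j) then y else 1)))
    ≡⟨ ∏²-* n _ _ ⟨
  ∏ (allFin n) (λ _ → ∏ (allFin n) (λ _ → 2)) * ∏ (allFin n) (λ i → ∏ (allFin n) (λ j → if does (i <? j) then y else 1))
    ≡⟨ cong₂ _*_ (∏²-const n 2) (trans (sym (∏-edges n _)) (∏-const (edges n) y)) ⟩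
  2 ^ (n * n) * y ^ length (edges n) ∎
  where
  open ≡-Reasoning
  H : Fin n → Fin n → Bool → ℕ
  H i j s = if does (i <? j) then G i j s else 1
  twos = ∏ (allFin n) (λ i → ∏ (allFin n) (λ j → if does (i <? j) then 2 else 1))
  pointwise : ∀ i j b → ∑ bools (λ s → if b then G i j s else 1) * (if b then 2 else 1) ≡ 2 * (if b then y else 1)
  pointwise i j true  = trans (cong (λ t → (G i j false + t) * 2) (+-identityʳ (G i j true)))
                              (trans (cong (_* 2) (G≡y i j)) (*-comm y 2))
  pointwise i j false = refl

ι-∧ : ∀ a b → ι (a ∧ b) ≡ ι a * ι b
ι-∧ false b = refl
ι-∧ true  b = sym (+-identityʳ (ι b))

∑-cartesian-∷ : (xs : List A) (xss : List (List A)) (F : List A → ℕ) →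
  ∑ (cartesian (xs ∷ xss)) F ≡ ∑ xs (λ x → ∑ (cartesian xss) (λ ω → F (x ∷ ω)))
∑-cartesian-∷ xs xss F = trans (∑-concatMap _ xs F) (∑-cong xs (λ x → ∑-map (x ∷_) (cartesian xss) F))

length-cartesian : (ch : A → List B) (es : List A) → length (cartesian (map ch es)) ≡ ∏ es (length ∘ ch)
length-cartesian ch []       = refl
length-cartesian ch (e ∷ es) = begin
  length (cartesian (map ch (e ∷ es)))                        ≡⟨ length-∑ (cartesian (map ch (e ∷ es))) ⟩
  ∑ (cartesian (map ch (e ∷ es))) (λ _ → 1)                   ≡⟨ ∑-cartesian-∷ (ch e) (map ch es) _ ⟩
  ∑ (ch e) (λ _ → ∑ (cartesian (map ch es)) (λ _ → 1))        ≡⟨ ∑-const (ch e) _ ⟩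
  length (ch e) * ∑ (cartesian (map ch es)) (λ _ → 1)         ≡⟨ cong (length (ch e) *_) (length-∑ (cartesian (map ch es))) ⟨
  length (ch e) * length (cartesian (map ch es))              ≡⟨ cong (length (ch e) *_) (length-cartesian ch es) ⟩
  length (ch e) * ∏ es (length ∘ ch)                          ∎
  where open ≡-Reasoning

-- Independence of the choices: for fixed `C` the conditions at different edges concern different
-- coordinates of `ω`, so the count factors over the edges.
∑-cartesian-kills : ∀ {n} (C : Cochain n) (g : A → B → Vec₂ (Edge n)) (ch : A → List B) (es : List A) →
  ∑ (cartesian (map ch es)) (λ ω → ι (kills? C (zipWith g es ω))) ≡
  ∏ es (λ e → ∑ (ch e) (λ w → ι (not ⟨ C , g e w ⟩)))
∑-cartesian-kills C g ch []       = refl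
∑-cartesian-kills C g ch (e ∷ es) = begin
  ∑ (cartesian (map ch (e ∷ es))) (λ ω → ι (kills? C (zipWith g (e ∷ es) ω)))
    ≡⟨ ∑-cartesian-∷ (ch e) (map ch es) _ ⟩
  ∑ (ch e) (λ w → ∑ Ω (λ ω → ι (not ⟨ C , g e w ⟩ ∧ kills? C (zipWith g es ω))))
    ≡⟨ ∑-cong (ch e) (λ w → trans (∑-cong Ω (λ ω → ι-∧ (not ⟨ C , g e w ⟩) _)) (∑-*ˡ Ω (ι (not ⟨ C , g e w ⟩)) _)) ⟩
  ∑ (ch e) (λ w → ι (not ⟨ C , g e w ⟩) * ∑ Ω (λ ω → ι (kills? C (zipWith g es ω))))
    ≡⟨ ∑-*ʳ (ch e) _ _ ⟩
  ∑ (ch e) (λ w → ι (not ⟨ C , g e w ⟩)) * ∑ Ω (λ ω → ι (kills? C (zipWith g es ω)))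
    ≡⟨ cong (∑ (ch e) (λ w → ι (not ⟨ C , g e w ⟩)) *_) (∑-cartesian-kills C g ch es) ⟩
  _ ∎
  where
  open ≡-Reasoning
  Ω = cartesian (map ch es)

∑-single : ∀ {n} (u : Fin n) → ∑ (allFin n) (λ w → ι (does (w ≟ u))) ≡ 1
∑-single {suc n} zero    = trans (∑-allFin-suc n (λ w → ι (does (w ≟ zero))))
  (cong suc (trans (∑-const (allFin n) 0) (*-zeroʳ (length (allFin n)))))
∑-single {suc n} (suc u) = trans (∑-allFin-suc n (λ w → ι (does (w ≟ suc u)))) (∑-single u)

-- Each of `u` and `v` excludes one vertex. As an inequality this also covers a pair with `u ≡ v`,
-- so it can be used without membership in `edges n`.
length-choices : ∀ n e → n ∸ 2 ≤ length (choices n e)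
length-choices n (u , v) = m≤n+o⇒m∸n≤o n 2 (begin
  n
    ≡⟨ trans (sym (length-allFin n)) (length-∑ (allFin n)) ⟩
  ∑ (allFin n) (λ _ → 1)
    ≤⟨ lemma (allFin n) ⟩
  ∑ (allFin n) (λ w → ι (does (w ≟ u))) + ∑ (allFin n) (λ w → ι (does (w ≟ v))) + length (choices n (u , v))
    ≡⟨ cong₂ (λ a b → a + b + length (choices n (u , v))) (∑-single u) (∑-single v) ⟩
  2 + length (choices n (u , v)) ∎)
  where
  open ≤-Reasoning
  matches : Fin n → List (Fin n) → ℕ
  matches t ws = ∑ ws (λ w → ι (does (w ≟ t)))
  others : List (Fin n) → ℕ
  others ws = length (filter (λ w → ¬? (w ≟ u) ×-dec ¬? (w ≟ v)) ws)
  lemma : ∀ ws → ∑ ws (λ _ → 1) ≤ matches u ws + matches v ws + others ws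
  lemma []       = z≤n
  lemma (w ∷ ws) with w ≟ u | w ≟ v
  ... | yes _ | yes _ = s≤s (≤-trans (lemma ws) (+-monoˡ-≤ (others ws) (+-monoʳ-≤ (matches u ws) (n≤1+n _))))
  ... | yes _ | no  _ = s≤s (lemma ws)
  ... | no  _ | yes _ = ≤-trans (s≤s (lemma ws)) (+-monoˡ-≤ (others ws) (≤-reflexive (sym (+-suc (matches u ws) (matches v ws)))))
  ... | no  _ | no  _ = ≤-trans (s≤s (lemma ws)) (≤-reflexive (sym (+-suc (matches u ws + matches v ws) (others ws))))

length-outcomes : ∀ n → (n ∸ 2) ^ length (edges n) ≤ length (outcomes n)
length-outcomes n = begin
  (n ∸ 2) ^ length (edges n)           ≡⟨ ∏-const (edges n) (n ∸ 2) ⟨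
  ∏ (edges n) (λ _ → n ∸ 2)            ≤⟨ ∏-mono-∈ (edges n) (λ {e} _ → length-choices n e) ⟩
  ∏ (edges n) (length ∘ choices n)     ≡⟨ length-cartesian (choices n) (edges n) ⟨
  length (outcomes n)                  ∎
  where open ≤-Reasoning

length-edges : ∀ n → length (edges n) ≤ n * n
length-edges n = begin
  length (edges n)                                    ≡⟨ length-∑ (edges n) ⟩
  ∑ (edges n) (λ _ → 1)                               ≡⟨ ∑-concatMap _ (allFin n) _ ⟩
  ∑ (allFin n) (λ i → ∑ (map (i ,_) (filter (i <?_) (allFin n))) (λ _ → 1))
    ≤⟨ ∑-mono (allFin n) (λ i → ≤-trans (≤-reflexive (∑-map (i ,_) (filter (i <?_) (allFin n)) _)) (∑-filter-≤ (i <?_) (allFin n) _)) ⟩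
  ∑ (allFin n) (λ _ → ∑ (allFin n) (λ _ → 1))         ≡⟨ ∑-const (allFin n) _ ⟩
  length (allFin n) * ∑ (allFin n) (λ _ → 1)          ≡⟨ cong₂ _*_ (length-allFin n) (trans (sym (length-∑ (allFin n))) (length-allFin n)) ⟩
  n * n                                               ∎
  where open ≤-Reasoning

∈-vecs : {xs : List A} → (∀ x → x ∈ xs) → ∀ {m} (v : Vec A m) → v ∈ vecs xs m
∈-vecs h []      = here refl
∈-vecs {xs = xs} h (x ∷ v) = ∈-concatMap⁺ (λ x → map (x ∷_) (vecs xs _)) (lose (h x) (∈-map⁺ (x ∷_) (∈-vecs h v)))

∈-bools : ∀ b → b ∈ bools
∈-bools false = here refl
∈-bools true  = there (here refl)

m<2^m : ∀ m → m < 2 ^ m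
m<2^m zero    = z<s
m<2^m (suc m) = ≤-trans (+-mono-≤ (m^n>0 2 m) (m<2^m m)) (≤-reflexive (cong (2 ^ m +_) (sym (+-identityʳ (2 ^ m)))))

-- Predicting a cochain from a sample of its columns

module FirstMoment (n D : ℕ) .{{n≢0 : NonZero n}} .{{D≢0 : NonZero D}} where
  -- Chebyshev lets a sample fail on a given edge with probability at most D²/K. Taking K = D⁴ makes
  -- this 1/D², small enough to outweigh the factor `D` paid for each failure.
  K = D * D * (D * D)
  M = length (edges n)

  instance
    DD≢0 : NonZero (D * D)
    DD≢0 = m*n≢0 D D
    K≢0 : NonZero K
    K≢0 = m*n≢0 (D * D) (D * D)

  agrees : Bool → Bool → Bool → Bool
  agrees s a b = not (s xor (a xor b))

  hit : Cochain n → Fin n × Fin n → Fin n → Bool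
  hit C (u , v) w = agrees (value C u v) (value C u w) (value C v w)

  extensions : Cochain n → Fin n × Fin n → ℕ
  extensions C (u , v) = ∑ (choices n (u , v)) (λ w → ι (not ⟨ C , ∂₂ u v w ⟩))

  -- Letting `w` range over all vertices gives every edge the same sample space, so that one sample
  -- can serve them all. The two added vertices always count as hits, as `value` vanishes on the
  -- diagonal; the loss of n against n - 2 is paid for in `normalisation`.
  extensions≤hits : ∀ C {e} → e ∈ edges n → extensions C e ≤ ∑ (allFin n) (ι ∘ hit C e)
  extensions≤hits C {u , v} e∈ = ≤-trans
    (∑-mono-∈ (choices n (u , v)) (λ {w} w∈ →
      let w≢u , w≢v = proj₂ (∈-filter⁻ (λ w → ¬? (w ≟ u) ×-dec ¬? (w ≟ v)) {xs = allFin n} w∈)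
      in ≤-reflexive (cong (ι ∘ not) (⟨,∂₂⟩ C (edge-≢ e∈) w≢u w≢v))))
    (∑-filter-≤ _ (allFin n) (ι ∘ hit C (u , v)))

  module _ (C : Cochain n) (e : Fin n × Fin n) where
    open Chebyshev (allFin n) (hit C e) D K public using (hits; bad; chebyshev)

  -- Chebyshev works edge by edge; exchanging the sums over edges and samples and then averaging
  -- yields a single sample for all edges.
  good-sample : ∀ C → Σ[ z ∈ Vec (Fin n) K ] ∑ (edges n) (λ e → ι (bad C e z)) * (D * D) ≤ M
  good-sample C =
    let z , _ , h = ∑-pigeonhole samples (λ z → count z * K) (M * (D * D)) total
    in z , *-cancelʳ-≤ _ _ (D * D) (≤-trans (≤-reflexive (*-assoc (count z) (D * D) (D * D))) h)
    where
    open ≤-Reasoning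
    samples = vecs (allFin n) K
    count : Vec (Fin n) K → ℕ
    count z = ∑ (edges n) (λ e → ι (bad C e z))
    0<l : 0 < length (allFin n)
    0<l = subst (0 <_) (sym (length-allFin n)) (>-nonZero⁻¹ n)
    0<samples : 0 < length samples
    0<samples = subst (0 <_) (sym (length-vecs (allFin n) K)) (m^n>0 (length (allFin n)) {{>-nonZero 0<l}} K)
    total : ∑ samples (λ z → count z * K) < suc (M * (D * D)) * length samples
    total = begin-strict
      ∑ samples (λ z → count z * K)
        ≡⟨ ∑-*ʳ samples K count ⟩
      ∑ samples count * K
        ≡⟨ cong (_* K) (∑-swap samples (edges n) _) ⟩
      ∑ (edges n) (λ e → ∑ samples (ι ∘ bad C e)) * K
        ≡⟨ ∑-*ʳ (edges n) K _ ⟨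
      ∑ (edges n) (λ e → ∑ samples (ι ∘ bad C e) * K)
        ≤⟨ ∑-mono (edges n) (λ e → chebyshev C e 0<l (>-nonZero⁻¹ K)) ⟩
      ∑ (edges n) (λ _ → D * D * length (allFin n) ^ K)
        ≡⟨ ∑-const (edges n) _ ⟩
      M * (D * D * length (allFin n) ^ K)
        ≡⟨ trans (cong (λ t → M * (D * D * t)) (sym (length-vecs (allFin n) K))) (sym (*-assoc M (D * D) _)) ⟩
      M * (D * D) * length samples
        <⟨ *-monoˡ-< (length samples) {{>-nonZero 0<samples}} (n<1+n (M * (D * D))) ⟩
      suc (M * (D * D)) * length samples ∎

  -- This is `D * K` times the frequency of `s` among the sampled sums, raised by 1/D. The summand
  -- `K` absorbs the sampling error and also keeps the weight away from 0.
  weight : Vec (Vec Bool n) K → Fin n → Fin n → Bool → ℕ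
  weight σ u v s = D * ∑ (toList σ) (λ col → ι (agrees s (lookup col u) (lookup col v))) + K

  weight-total : ∀ σ u v → weight σ u v false + weight σ u v true ≡ (D + 2) * K
  weight-total σ u v = begin
    D * h false + K + (D * h true + K)  ≡⟨ regroup D (h false) (h true) K ⟩
    D * (h false + h true) + 2 * K      ≡⟨ cong (λ t → D * t + 2 * K) h-total ⟩
    D * K + 2 * K                       ≡⟨ *-distribʳ-+ K D 2 ⟨
    (D + 2) * K                         ∎
    where
    open ≡-Reasoning
    h : Bool → ℕ
    h s = ∑ (toList σ) (λ col → ι (agrees s (lookup col u) (lookup col v)))
    complementary : ∀ b → ι (not b) + ι (not (not b)) ≡ 1
    complementary false = refl
    complementary true  = refl
    h-total : h false + h true ≡ K
    h-total = trans (sym (∑-+ (toList σ) _ _))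
      (trans (∑-cong (toList σ) (λ col → complementary (lookup col u xor lookup col v)))
        (trans (sym (length-∑ (toList σ))) (length-toList σ)))
    regroup : ∀ d a b k → d * a + k + (d * b + k) ≡ d * (a + b) + 2 * k
    regroup = ℕ-solve-∀

  columns : Cochain n → Vec (Fin n) K → Vec (Vec Bool n) K
  columns C = Vec.map (λ w → Vec.tabulate (λ u → value C u w))

  weight-columns : ∀ C z u v → weight (columns C z) u v (value C u v) ≡ D * hits C (u , v) z + K
  weight-columns C z u v = cong (λ t → D * t + K)
    (trans (cong (λ xs → ∑ xs _) (toList-map _ z)) (trans (∑-map _ (toList z) _)
      (∑-cong (toList z) (λ w → cong ι (cong₂ (agrees (value C u v))
        (lookup∘tabulate (λ u → value C u w) u) (lookup∘tabulate (λ u → value C u w) v))))))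

  -- Only an upper bound is wanted, so only underestimates hurt. On a good edge the raised frequency
  -- dominates the true one; on a bad edge the true one is at most 1 and the raised one at least
  -- 1/D.
  edge-bound : ∀ C z {e} → e ∈ edges n →
    D * K * extensions C e ≤ D ^ ι (bad C e z) * (n * weight (columns C z) (proj₁ e) (proj₂ e) (value C (proj₁ e) (proj₂ e)))
  edge-bound C z {e@(u , v)} e∈ = begin
    D * K * extensions C e
      ≤⟨ *-monoʳ-≤ (D * K) (extensions≤hits C e∈) ⟩
    D * K * μ
      ≤⟨ go (l * W ℕ.<? D * K * μ) ⟩
    D ^ ι (bad C e z) * (l * W)
      ≡⟨ cong (D ^ ι (bad C e z) *_) (cong₂ _*_ (length-allFin n) (sym (weight-columns C z u v))) ⟩
    D ^ ι (bad C e z) * (n * weight (columns C z) u v (value C u v)) ∎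
    where
    open ≤-Reasoning
    l = length (allFin n)
    μ = ∑ (allFin n) (ι ∘ hit C e)
    W = D * hits C e z + K
    go : (d : Dec (l * W < D * K * μ)) → D * K * μ ≤ D ^ ι (does d) * (l * W)
    go (no ≮)  = ≤-trans (≮⇒≥ ≮) (≤-reflexive (sym (*-identityˡ (l * W))))
    go (yes _) = begin
      D * K * μ          ≤⟨ *-monoʳ-≤ (D * K) (∑-ι≤length (allFin n) (hit C e)) ⟩
      D * K * l          ≡⟨ *-assoc D K l ⟩
      D * (K * l)        ≡⟨ cong (D *_) (*-comm K l) ⟩
      D * (l * K)        ≤⟨ *-monoʳ-≤ D (*-monoʳ-≤ l (m≤n+m K (D * hits C e z))) ⟩
      D * (l * W)        ≡⟨ cong (_* (l * W)) (*-identityʳ D) ⟨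
      D ^ 1 * (l * W)    ∎

  matrices : List (Vec (Vec Bool n) K)
  matrices = vecs (vecs bools n) K

  -- With `entry` in place of `value`, each factor reads its own matrix position, as `∑-cochains-∏`
  -- requires; `σ` is no longer tied to the cochain.
  likelihood : Vec (Vec Bool n) K → Cochain n → ℕ
  likelihood σ C = ∏ (edges n) (λ (u , v) → weight σ u v (entry C u v))

  cochain-bound : ∀ C → (D * K) ^ M * ∏ (edges n) (extensions C) ≤
    2 ^ (M / D) * n ^ M * ∑ matrices (λ σ → likelihood σ C)
  cochain-bound C =
    let z , few = good-sample C
        w = λ (e : Fin n × Fin n) → weight (columns C z) (proj₁ e) (proj₂ e)
    in begin
    (D * K) ^ M * ∏ (edges n) (extensions C)
      ≡⟨ trans (cong (_* ∏ (edges n) (extensions C)) (sym (∏-const (edges n) (D * K)))) (sym (∏-* (edges n) _ _)) ⟩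
    ∏ (edges n) (λ e → D * K * extensions C e)
      ≤⟨ ∏-mono-∈ (edges n) (edge-bound C z) ⟩
    ∏ (edges n) (λ e → D ^ ι (bad C e z) * (n * w e (value C (proj₁ e) (proj₂ e))))
      ≡⟨ ∏-* (edges n) _ _ ⟩
    ∏ (edges n) (λ e → D ^ ι (bad C e z)) * ∏ (edges n) (λ e → n * w e (value C (proj₁ e) (proj₂ e)))
      ≡⟨ cong₂ _*_ (∏-^ (edges n) D _) (trans (∏-* (edges n) _ _) (cong₂ _*_ (∏-const (edges n) n)
           (∏-cong-∈ (edges n) (λ {e} e∈ → cong (w e) (value-< C (edge-< e∈)))))) ⟩
    D ^ ∑ (edges n) (λ e → ι (bad C e z)) * (n ^ M * likelihood (columns C z) C)
      -- The actual columns become one summand among all matrices, which forgets how they and the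
      -- sample depend on `C`.
      ≤⟨ *-mono-≤ (few-bad (∑ (edges n) (λ e → ι (bad C e z))) few) (*-monoʳ-≤ (n ^ M)
           (≤∑ (λ σ → likelihood σ C) (∈-vecs (∈-vecs ∈-bools) (columns C z)))) ⟩
    2 ^ (M / D) * (n ^ M * ∑ matrices (λ σ → likelihood σ C))
      ≡⟨ *-assoc (2 ^ (M / D)) (n ^ M) _ ⟨
    2 ^ (M / D) * n ^ M * ∑ matrices (λ σ → likelihood σ C) ∎
    where
    open ≤-Reasoning
    -- The cost `D` of a bad edge is estimated by `2 ^ D`, and there are at most M/D² of them.
    few-bad : ∀ b → b * (D * D) ≤ M → D ^ b ≤ 2 ^ (M / D)
    few-bad b h = begin
      D ^ b          ≤⟨ ^-monoˡ-≤ b (<⇒≤ (m<2^m D)) ⟩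
      (2 ^ D) ^ b    ≡⟨ ^-*-assoc 2 D b ⟩
      2 ^ (D * b)    ≤⟨ ^-monoʳ-≤ 2 (subst (_≤ M / D) (m*n/n≡m (D * b) D) (/-monoˡ-≤ D (≤-trans (≤-reflexive (regroup D b)) h))) ⟩
      2 ^ (M / D)    ∎
      where
      regroup : ∀ d b → d * b * d ≡ b * (d * d)
      regroup = ℕ-solve-∀

  total : ℕ
  total = ∑ (outcomes n) (λ ω → annihilators n (faceBoundaries n ω))

  total≡ : total ≡ ∑ (cochains n) (λ C → ∏ (edges n) (extensions C))
  total≡ = trans (∑-swap (outcomes n) (cochains n) _)
    (∑-cong (cochains n) (λ C → ∑-cartesian-kills C _ (choices n) (edges n)))

  -- Every cocycle is counted `2 ^ (n * n - M)` times in `annihilators`, once for each filling of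
  -- the free entries. Divided out, the inequality says that the numbers of cocycles, summed over
  -- all outcomes, amount to at most `n ^ M * 2 ^ (M / D + n * K)` times (1 + 2/D)^M.
  first-moment : (D * K) ^ M * total * 2 ^ M ≤
    2 ^ (M / D) * n ^ M * (2 ^ (n * K) * (2 ^ (n * n) * ((D + 2) * K) ^ M))
  first-moment = begin
    (D * K) ^ M * total * 2 ^ M
      ≡⟨ cong (λ t → (D * K) ^ M * t * 2 ^ M) total≡ ⟩
    (D * K) ^ M * ∑ (cochains n) (λ C → ∏ (edges n) (extensions C)) * 2 ^ M
      ≡⟨ cong (_* 2 ^ M) (∑-*ˡ (cochains n) ((D * K) ^ M) _) ⟨
    ∑ (cochains n) (λ C → (D * K) ^ M * ∏ (edges n) (extensions C)) * 2 ^ M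
      ≤⟨ *-monoˡ-≤ (2 ^ M) (∑-mono (cochains n) cochain-bound) ⟩
    ∑ (cochains n) (λ C → c * ∑ matrices (λ σ → likelihood σ C)) * 2 ^ M
      ≡⟨ cong (_* 2 ^ M) (∑-*ˡ (cochains n) c _) ⟩
    c * ∑ (cochains n) (λ C → ∑ matrices (λ σ → likelihood σ C)) * 2 ^ M
      ≡⟨ cong (λ t → c * t * 2 ^ M) (∑-swap (cochains n) matrices _) ⟩
    c * ∑ matrices (λ σ → ∑ (cochains n) (likelihood σ)) * 2 ^ M
      ≡⟨ trans (*-assoc c _ (2 ^ M)) (cong (c *_) (sym (∑-*ʳ matrices (2 ^ M) _))) ⟩
    c * ∑ matrices (λ σ → ∑ (cochains n) (likelihood σ) * 2 ^ M)
      ≡⟨ cong (c *_) (∑-cong matrices (λ σ → ∑-cochains-∏ n (weight σ) _ (weight-total σ))) ⟩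
    c * ∑ matrices (λ _ → 2 ^ (n * n) * ((D + 2) * K) ^ M)
      ≡⟨ cong (c *_) (∑-const matrices _) ⟩
    c * (length matrices * (2 ^ (n * n) * ((D + 2) * K) ^ M))
      ≡⟨ cong (λ t → c * (t * (2 ^ (n * n) * ((D + 2) * K) ^ M)))
           (trans (length-vecs (vecs bools n) K) (trans (cong (_^ K) (length-vecs bools n)) (^-*-assoc 2 n K))) ⟩
    c * (2 ^ (n * K) * (2 ^ (n * n) * ((D + 2) * K) ^ M)) ∎
    where
    open ≤-Reasoning
    c = 2 ^ (M / D) * n ^ M

-- Choice of parameters

markov : {P : A → Set} (P? : Decidable P) (xs : List A) (f : A → ℕ) (c : ℕ) →
         (∀ {x} → P x → c ≤ f x) → length (filter P? xs) * c ≤ ∑ xs f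
markov P? []       f c h = z≤n
markov P? (x ∷ xs) f c h with P? x
... | yes px = +-mono-≤ (h px) (markov P? xs f c h)
... | no  _  = ≤-trans (markov P? xs f c h) (m≤n+m _ (f x))

^-distribʳ-* : ∀ a b m → (a * b) ^ m ≡ a ^ m * b ^ m
^-distribʳ-* a b zero    = refl
^-distribʳ-* a b (suc m) = trans (cong (a * b *_) (^-distribʳ-* a b m)) (identity a b (a ^ m) (b ^ m))
  where
  identity : ∀ a b x y → a * b * (x * y) ≡ a * x * (b * y)
  identity = ℕ-solve-∀

m<[1+m/n]*n : ∀ m n .{{_ : NonZero n}} → m < suc (m / n) * n
m<[1+m/n]*n m n = subst (_< suc (m / n) * n) (sym (m≡m%n+[m/n]*n m n)) (+-monoˡ-< (m / n * n) (m%n<n m n))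

-- (1 − 1/(m+1))^j ≥ 1 − j/(m+1), cleared of denominators and subtractions.
bernoulli : ∀ m j → suc m ^ j * suc m ≤ m ^ j * suc m + j * suc m ^ j
bernoulli m zero    = ≤-reflexive (sym (+-identityʳ _))
bernoulli m (suc j) = begin
  suc m * p * suc m                                 ≡⟨ *-assoc (suc m) p (suc m) ⟩
  suc m * (p * suc m)                               ≤⟨ *-monoʳ-≤ (suc m) (bernoulli m j) ⟩
  suc m * (m ^ j * suc m + j * p)                   ≡⟨ expand m (m ^ j) j p ⟩
  m * m ^ j * suc m + (suc m * m ^ j + j * (suc m * p))
    ≤⟨ +-monoʳ-≤ (m * m ^ j * suc m) (+-monoˡ-≤ (j * (suc m * p)) (*-monoʳ-≤ (suc m) (^-monoˡ-≤ j (n≤1+n m)))) ⟩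
  m * m ^ j * suc m + suc j * (suc m * p)           ∎
  where
  open ≤-Reasoning
  p = suc m ^ j
  expand : ∀ m r j p → (1 + m) * (r * (1 + m) + j * p) ≡ m * r * (1 + m) + ((1 + m) * r + j * ((1 + m) * p))
  expand = ℕ-solve-∀

-- Bernoulli with k/(m+1) at most 1/2, added to itself to clear the fraction.
growth-doubling : ∀ m k → k + k ≤ suc m → suc m ^ k ≤ 2 * m ^ k
growth-doubling m k 2k≤ = *-cancelʳ-≤ p (2 * m ^ k) (suc m) (+-cancelʳ-≤ (p * suc m) _ _ (begin
  p * suc m + p * suc m                                   ≤⟨ +-mono-≤ (bernoulli m k) (bernoulli m k) ⟩
  (m ^ k * suc m + k * p) + (m ^ k * suc m + k * p)       ≡⟨ regroup (m ^ k) (suc m) k p ⟩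
  2 * m ^ k * suc m + p * (k + k)                         ≤⟨ +-monoʳ-≤ (2 * m ^ k * suc m) (*-monoʳ-≤ p 2k≤) ⟩
  2 * m ^ k * suc m + p * suc m                           ∎))
  where
  open ≤-Reasoning
  p = suc m ^ k
  regroup : ∀ r s k p → (r * s + k * p) + (r * s + k * p) ≡ 2 * r * s + p * (k + k)
  regroup = ℕ-solve-∀

-- Each block of `k` factors at most doubles the ratio. The exponent is padded to `k * t`, and the
-- padding is cancelled against `m ^ d`.
growth : ∀ m k t e .{{_ : NonZero m}} → k + k ≤ suc m → e ≤ k * t → suc m ^ e ≤ 2 ^ t * m ^ e
growth m k t e 2k≤ e≤ with m≤n⇒∃[o]m+o≡n e≤
... | d , eq = *-cancelʳ-≤ _ _ (m ^ d) {{m^n≢0 m d}} (begin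
  suc m ^ e * m ^ d        ≤⟨ *-monoʳ-≤ (suc m ^ e) (^-monoˡ-≤ d (n≤1+n m)) ⟩
  suc m ^ e * suc m ^ d    ≡⟨ ^-distribˡ-+-* (suc m) e d ⟨
  suc m ^ (e + d)          ≡⟨ trans (cong (suc m ^_) eq) (sym (^-*-assoc (suc m) k t)) ⟩
  (suc m ^ k) ^ t          ≤⟨ ^-monoˡ-≤ t (growth-doubling m k 2k≤) ⟩
  (2 * m ^ k) ^ t          ≡⟨ ^-distribʳ-* 2 (m ^ k) t ⟩
  2 ^ t * (m ^ k) ^ t      ≡⟨ cong (2 ^ t *_) (trans (^-*-assoc m k t) (cong (m ^_) (sym eq))) ⟩
  2 ^ t * m ^ (e + d)      ≡⟨ cong (2 ^ t *_) (^-distribˡ-+-* m e d) ⟩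
  2 ^ t * (m ^ e * m ^ d)  ≡⟨ *-assoc (2 ^ t) (m ^ e) (m ^ d) ⟨
  2 ^ t * m ^ e * m ^ d    ∎)
  where open ≤-Reasoning

-- Two losses per edge, n/(n-2) with n = 2 + N and 1 + 2/D with D = 2m, are each at most 1 + 1/m;
-- hence the exponent `2 * M` passed to `growth`.
normalisation : ∀ m k t M N .{{_ : NonZero m}} → k + k ≤ suc m → 2 * M ≤ k * t → 2 * m ≤ N →
  ((2 + N) * (2 * m + 2)) ^ M ≤ 2 ^ t * (N * (2 * m)) ^ M
normalisation m k t M N 2k≤ M≤ m≤N = *-cancelʳ-≤ _ _ (m ^ (2 * M)) {{m^n≢0 m (2 * M)}} (begin
  x ^ M * m ^ (2 * M)                      ≡⟨ cong (x ^ M *_) (^-*-assoc m 2 M) ⟨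
  x ^ M * (m ^ 2) ^ M                      ≡⟨ ^-distribʳ-* x (m ^ 2) M ⟨
  (x * m ^ 2) ^ M                          ≤⟨ ^-monoˡ-≤ M step ⟩
  (y * suc m ^ 2) ^ M                      ≡⟨ ^-distribʳ-* y (suc m ^ 2) M ⟩
  y ^ M * (suc m ^ 2) ^ M                  ≡⟨ cong (y ^ M *_) (^-*-assoc (suc m) 2 M) ⟩
  y ^ M * suc m ^ (2 * M)                  ≤⟨ *-monoʳ-≤ (y ^ M) (growth m k t (2 * M) 2k≤ M≤) ⟩
  y ^ M * (2 ^ t * m ^ (2 * M))            ≡⟨ regroup (y ^ M) (2 ^ t) (m ^ (2 * M)) ⟩
  2 ^ t * y ^ M * m ^ (2 * M)              ∎)
  where
  open ≤-Reasoning
  x = (2 + N) * (2 * m + 2)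
  y = N * (2 * m)
  regroup : ∀ a b c → a * (b * c) ≡ b * a * c
  regroup = ℕ-solve-∀
  left : ∀ m N → (2 + N) * (2 * m + 2) * (m * (m * 1)) ≡ (N * m + 2 * m) * (2 * m * (1 + m))
  left = ℕ-solve-∀
  right : ∀ m N → (N * m + N) * (2 * m * (1 + m)) ≡ N * (2 * m) * ((1 + m) * ((1 + m) * 1))
  right = ℕ-solve-∀
  step : x * m ^ 2 ≤ y * suc m ^ 2
  step = begin
    x * m ^ 2                               ≡⟨ left m N ⟩
    (N * m + 2 * m) * (2 * m * (1 + m))     ≤⟨ *-monoˡ-≤ (2 * m * (1 + m)) (+-monoʳ-≤ (N * m) m≤N) ⟩
    (N * m + N) * (2 * m * (1 + m))         ≡⟨ right m N ⟩
    y * suc m ^ 2                           ∎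

-- By `annihilators-rank` there are at least 2^(M - r₂) cocycles, M being the number of edges, and
-- `b` is at most M - r₂. Counting cocycles instead of cohomology classes costs only the rank `r₁`,
-- at most n, in an exponent of order n². The powers of 2 account for the free matrix entries.
bigH₁-annihilators : ∀ n p q ω → 0 < p → BigH₁ n p q ω →
  2 ^ (n * n) * 2 ^ (n * n / suc q) ≤ annihilators n (faceBoundaries n ω) * 2 ^ length (edges n)
bigH₁-annihilators n p q ω 0<p (b , (r₁ , r₂ , _ , rank₂ , eq) , big) = begin
  2 ^ (n * n) * 2 ^ T              ≤⟨ *-mono-≤ (annihilators-rank n rank₂) (^-monoʳ-≤ 2 T≤b) ⟩
  2 ^ r₂ * Z * 2 ^ b               ≡⟨ regroup (2 ^ r₂) Z (2 ^ b) ⟩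
  Z * (2 ^ b * 2 ^ r₂)             ≡⟨ cong (Z *_) (^-distribˡ-+-* 2 b r₂) ⟨
  Z * 2 ^ (b + r₂)                 ≤⟨ *-monoʳ-≤ Z (^-monoʳ-≤ 2 (subst (b + r₂ ≤_) eq (+-monoˡ-≤ r₂ (m≤m+n b r₁)))) ⟩
  Z * 2 ^ length (edges n)         ∎
  where
  open ≤-Reasoning
  T = n * n / suc q
  Z = annihilators n (faceBoundaries n ω)
  regroup : ∀ a b c → a * b * c ≡ b * (c * a)
  regroup = ℕ-solve-∀
  T≤b : T ≤ b
  T≤b = subst (T ≤_) (m*n/n≡m b (suc q)) (/-monoˡ-≤ (suc q)
    (≤-trans (m≤n*m (n * n) p {{>-nonZero 0<p}}) (<⇒≤ big)))

module Parameters (q c : ℕ) where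
  Q = suc q
  -- `m = 2 * k` is what `growth-doubling` asks for, and `D = 2 * m` turns 1 + 2/D into 1 + 1/m. The
  -- 8 keeps `2 * M / k` below a quarter of n²/Q.
  k = 8 * Q
  m = 2 * k
  D = 2 * m
  K = D * D * (D * D)
  threshold = D * (K + 1 + c)

  -- In units of n²/(32 Q), the bad edges take 1, the normalisation 8, and the columns together with
  -- the rounding and `c` take 1, thanks to `threshold`: 10 out of 32.
  exponents : ∀ n M → 0 < n → threshold ≤ n → M ≤ n * n →
    M / D + n * K + suc (2 * M / k) + c ≤ n * n / Q
  exponents n M 0<n N≤n M≤ = s≤s⁻¹ (*-cancelʳ-< Q _ _ (≤-<-trans (*-cancelˡ-≤ 32 bound) (m<[1+m/n]*n (n * n) Q)))
    where
    open ≤-Reasoning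
    s = M / D
    t = 2 * M / k
    expand : ∀ s n K t c Q → 32 * ((s + n * K + (1 + t) + c) * Q) ≡
      s * (2 * (2 * (8 * Q))) + 4 * (t * (8 * Q)) + 2 * (2 * (8 * Q)) * (n * K + (1 + c))
    expand = ℕ-solve-∀
    collect : ∀ n K c d → d * (n * K + n * (1 + c)) ≡ d * (K + 1 + c) * n
    collect = ℕ-solve-∀
    squares : ∀ x → x + 4 * (2 * x) + x ≡ 10 * x
    squares = ℕ-solve-∀
    bound : 32 * ((s + n * K + suc t + c) * Q) ≤ 32 * (n * n)
    bound = begin
      32 * ((s + n * K + suc t + c) * Q)
        ≡⟨ expand s n K t c Q ⟩
      s * D + 4 * (t * k) + D * (n * K + (1 + c))
        ≤⟨ +-mono-≤ (+-mono-≤ (≤-trans (m/n*n≤m M D) M≤) (*-monoʳ-≤ 4 (≤-trans (m/n*n≤m (2 * M) k) (*-monoʳ-≤ 2 M≤))))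
             (*-monoʳ-≤ D (+-monoʳ-≤ (n * K) (m≤n*m (1 + c) n {{>-nonZero 0<n}}))) ⟩
      n * n + 4 * (2 * (n * n)) + D * (n * K + n * (1 + c))
        ≡⟨ cong (n * n + 4 * (2 * (n * n)) +_) (collect n K c D) ⟩
      n * n + 4 * (2 * (n * n)) + threshold * n
        ≤⟨ +-monoʳ-≤ (n * n + 4 * (2 * (n * n))) (*-monoˡ-≤ n N≤n) ⟩
      n * n + 4 * (2 * (n * n)) + n * n
        ≡⟨ squares (n * n) ⟩
      10 * (n * n)
        ≤⟨ *-monoˡ-≤ (n * n) (m≤m+n 10 22) ⟩
      32 * (n * n) ∎

  D≤N : ∀ N → threshold ≤ 2 + N → D ≤ N
  D≤N N h = +-cancelˡ-≤ 2 D N (begin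
    2 + D            ≤⟨ +-monoˡ-≤ D 2≤D ⟩
    D + D            ≡⟨ double D ⟩
    D * (1 + 1 + 0)  ≤⟨ *-monoʳ-≤ D (+-mono-≤ (+-monoˡ-≤ 1 (>-nonZero⁻¹ K)) z≤n) ⟩
    threshold        ≤⟨ h ⟩
    2 + N            ∎)
    where
    open ≤-Reasoning
    double : ∀ d → d + d ≡ d * (1 + 1 + 0)
    double = ℕ-solve-∀
    2≤D : 2 ≤ D
    2≤D = *-monoʳ-≤ 2 (>-nonZero⁻¹ m)

  module Bound (N : ℕ) (large : threshold ≤ 2 + N) where
    -- In this form `n ∸ 2`, the base in `length-outcomes`, computes to `N`.
    n = 2 + N
    M = length (edges n)
    T = n * n / Q
    open FirstMoment n D using (total; first-moment)

    -- `BigH₁` is not decided. Its decidable consequence from `bigH₁-annihilators` is filtered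
    -- instead, as `ProbAtMost` only asks for a list that contains the outcomes in question.
    big : List (List _)
    big = filter (λ ω → 2 ^ (n * n) * 2 ^ T ≤? annihilators n (faceBoundaries n ω) * 2 ^ M) (outcomes n)

    big-moment : length big * (2 ^ (n * n) * 2 ^ T) ≤ total * 2 ^ M
    big-moment = ≤-trans (markov _ (outcomes n) _ _ (λ h → h)) (≤-reflexive (∑-*ʳ (outcomes n) (2 ^ M) _))

    -- The successor rounds 2M/k up, so that `k` times it is at least `2 * M`.
    x = M / D + n * K + suc (2 * M / k)

    big-scaled : length big * 2 ^ T ≤ 2 ^ x * N ^ M
    big-scaled = *-cancelʳ-≤ _ _ (D ^ M) {{m^n≢0 D M}} (begin
      g * 2 ^ T * D ^ M
        ≤⟨ *-cancelʳ-≤ _ _ (2 ^ (n * n) * K ^ M) {{m*n≢0 _ _ {{m^n≢0 2 (n * n)}} {{m^n≢0 K M}}}} scaled ⟩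
      2 ^ (M / D) * 2 ^ (n * K) * (n * (D + 2)) ^ M
        ≤⟨ *-monoʳ-≤ (2 ^ (M / D) * 2 ^ (n * K)) (normalisation m k (suc (2 * M / k)) M N 2k≤ M≤ (D≤N N large)) ⟩
      2 ^ (M / D) * 2 ^ (n * K) * (2 ^ suc (2 * M / k) * (N * D) ^ M)
        ≡⟨ cong (λ r → 2 ^ (M / D) * 2 ^ (n * K) * (2 ^ suc (2 * M / k) * r)) (^-distribʳ-* N D M) ⟩
      2 ^ (M / D) * 2 ^ (n * K) * (2 ^ suc (2 * M / k) * (N ^ M * D ^ M))
        ≡⟨ regroup₃ (2 ^ (M / D)) (2 ^ (n * K)) (2 ^ suc (2 * M / k)) (N ^ M) (D ^ M) ⟩
      2 ^ (M / D) * 2 ^ (n * K) * 2 ^ suc (2 * M / k) * N ^ M * D ^ M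
        ≡⟨ cong (λ r → r * 2 ^ suc (2 * M / k) * N ^ M * D ^ M) (^-distribˡ-+-* 2 (M / D) (n * K)) ⟨
      2 ^ (M / D + n * K) * 2 ^ suc (2 * M / k) * N ^ M * D ^ M
        ≡⟨ cong (λ r → r * N ^ M * D ^ M) (^-distribˡ-+-* 2 (M / D + n * K) (suc (2 * M / k))) ⟨
      2 ^ x * N ^ M * D ^ M ∎)
      where
      open ≤-Reasoning
      g = length big
      2k≤ : k + k ≤ suc m
      2k≤ = ≤-trans (≤-reflexive (cong (k +_) (sym (+-identityʳ k)))) (n≤1+n m)
      M≤ : 2 * M ≤ k * suc (2 * M / k)
      M≤ = ≤-trans (<⇒≤ (m<[1+m/n]*n (2 * M) k)) (≤-reflexive (*-comm (suc (2 * M / k)) k))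
      regroup₁ : ∀ g t d e l → g * t * d * (e * l) ≡ d * l * (g * (e * t))
      regroup₁ = ℕ-solve-∀
      regroup₂ : ∀ s v w e d l → s * v * (w * (e * (d * l))) ≡ s * w * (v * d) * (e * l)
      regroup₂ = ℕ-solve-∀
      regroup₃ : ∀ s w t a d → s * w * (t * (a * d)) ≡ s * w * t * a * d
      regroup₃ = ℕ-solve-∀
      scaled : g * 2 ^ T * D ^ M * (2 ^ (n * n) * K ^ M) ≤
               2 ^ (M / D) * 2 ^ (n * K) * (n * (D + 2)) ^ M * (2 ^ (n * n) * K ^ M)
      scaled = begin
        g * 2 ^ T * D ^ M * (2 ^ (n * n) * K ^ M)
          ≡⟨ regroup₁ g (2 ^ T) (D ^ M) (2 ^ (n * n)) (K ^ M) ⟩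
        D ^ M * K ^ M * (g * (2 ^ (n * n) * 2 ^ T))
          ≡⟨ cong (_* (g * (2 ^ (n * n) * 2 ^ T))) (^-distribʳ-* D K M) ⟨
        (D * K) ^ M * (g * (2 ^ (n * n) * 2 ^ T))
          ≤⟨ *-monoʳ-≤ ((D * K) ^ M) big-moment ⟩
        (D * K) ^ M * (total * 2 ^ M)
          ≡⟨ *-assoc ((D * K) ^ M) total (2 ^ M) ⟨
        (D * K) ^ M * total * 2 ^ M
          ≤⟨ first-moment ⟩
        2 ^ (M / D) * n ^ M * (2 ^ (n * K) * (2 ^ (n * n) * ((D + 2) * K) ^ M))
          ≡⟨ cong (λ r → 2 ^ (M / D) * n ^ M * (2 ^ (n * K) * (2 ^ (n * n) * r))) (^-distribʳ-* (D + 2) K M) ⟩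
        2 ^ (M / D) * n ^ M * (2 ^ (n * K) * (2 ^ (n * n) * ((D + 2) ^ M * K ^ M)))
          ≡⟨ regroup₂ (2 ^ (M / D)) (n ^ M) (2 ^ (n * K)) (2 ^ (n * n)) ((D + 2) ^ M) (K ^ M) ⟩
        2 ^ (M / D) * 2 ^ (n * K) * (n ^ M * (D + 2) ^ M) * (2 ^ (n * n) * K ^ M)
          ≡⟨ cong (λ r → 2 ^ (M / D) * 2 ^ (n * K) * r * (2 ^ (n * n) * K ^ M)) (^-distribʳ-* n (D + 2) M) ⟨
        2 ^ (M / D) * 2 ^ (n * K) * (n * (D + 2)) ^ M * (2 ^ (n * n) * K ^ M) ∎

    big-small : length big * suc c ≤ length (outcomes n)
    big-small = ≤-trans (*-cancelʳ-≤ _ _ (2 ^ x) {{m^n≢0 2 x}} (begin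
      -- The spare factor `2 ^ c`, for which `exponents` leaves room, dominates `suc c`.
      g * suc c * 2 ^ x        ≤⟨ *-monoˡ-≤ (2 ^ x) (*-monoʳ-≤ g (m<2^m c)) ⟩
      g * 2 ^ c * 2 ^ x        ≡⟨ regroup g (2 ^ c) (2 ^ x) ⟩
      g * (2 ^ x * 2 ^ c)      ≡⟨ cong (g *_) (^-distribˡ-+-* 2 x c) ⟨
      g * 2 ^ (x + c)          ≤⟨ *-monoʳ-≤ g (^-monoʳ-≤ 2 (exponents n M z<s large (length-edges n))) ⟩
      g * 2 ^ T                ≤⟨ big-scaled ⟩
      2 ^ x * N ^ M            ≡⟨ *-comm (2 ^ x) (N ^ M) ⟩
      N ^ M * 2 ^ x            ∎)) (length-outcomes n)
      where
      open ≤-Reasoning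
      g = length big
      regroup : ∀ a b c → a * b * c ≡ a * (c * b)
      regroup = ℕ-solve-∀

theorem2 : ∀ (p q a c : ℕ) → 0 < p → 0 < a →
    ∃[ N ] (∀ n → N ≤ n → 3 ≤ n → ProbAtMost n (BigH₁ n p q) a c)
theorem2 p q a c 0<p 0<a = threshold , bound
  where
  open Parameters q c
  bound : ∀ n → threshold ≤ n → 3 ≤ n → ProbAtMost n (BigH₁ n p q) a c
  bound (suc zero) _ (s≤s ())
  bound (suc (suc N)) large _ =
    big , filter-⊆ _ (outcomes n) ,
    (λ ω ω∈ h → ∈-filter⁺ _ ω∈ (bigH₁-annihilators n p q ω 0<p h)) ,
    ≤-trans big-small (m≤n*m (length (outcomes n)) a {{>-nonZero 0<a}})
    where open Bound N large
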